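{- Let $f:2^N\to\mathbb R$ be a monotone submodular function with curvature $c$, and let $\mathcal D$ be a product distribution on $2^N$ with bounded marginals. Then \textsc{MaxMargCont} is a $((1-c)^2-o(1))$-OPS algorithm: given a sufficiently large polynomial number of samples $(S_j,f(S_j))$ with $S_j$ i.i.d. from $\mathcal D$, with probability at least $1-\delta$ ($\delta\in[0,1)$ a constant) it returns a set $S$ with $|S|=k$ and $f(S)\ge((1-c)^2-o(1))\max_{T:|T|\le k}f(T)$.
   Context: $N=\{e_1,\dots,e_n\}$. $f_S(e)=f(S\cup\{e\})-f(S)$; $f$ is monotone if $f_S(e)\ge0$ and submodular if $f_S(e)\ge f_T(e)$ for all $S\subseteq T$. The curvature of $f$ is $c=1-\min_{e\in N,S\subseteq N}f_{S\setminus\{e\}}(e)/f(\{e\})$. A product distribution includes each element independently; it has bounded marginals if for every $e$, both $\Pr[e\in S]$ and $\Pr[e\notin S]$ ($S\sim\mathcal D$) lie between $1/\mathrm{poly}(n)$ and $1-1/\mathrm{poly}(n)$. \textsc{MaxMargCont}: for each $i$, let $\mathcal S_i$ (resp. $\mathcal S_{ -i}$) be the samples containing (resp. not containing) $e_i$, compute $\hat v_i=\frac{1}{|\mathcal S_i|}\sum_{S\in\mathcal S_i}f(S)-\frac{1}{|\mathcal S_{ -i}|}\sum_{S\in\mathcal S_{ -i}}f(S)$, and return $\arg\max_{|T|=k}\sum_{e_i\in T}\hat v_i$.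
   Formalization: f is additionally assumed nonnegative (otherwise false: f(S)=2|S|-1 has (1-c)^2=4), and δ=0 is excluded, since then all samples may coincide with positive probability and the guarantee fails. -}

module Defs where

open import Algebra.Bundles using (CommutativeRing)
import Algebra.Definitions.RawMonoid as RawMonoid
open import Data.Bool.Base using (if_then_else_)
open import Data.Fin.Base using (Fin)
open import Data.Fin.Subset
  using (Subset; Side; inside; outside; ⁅_⁆; _∪_; _⊆_; ∣_∣)
  renaming (_-_ to _∖_; ⊥ to ∅)
open import Data.Fin.Subset.Properties using (_∈?_)
open import Data.List.Base as List
  using (List; []; _∷_; _++_; map; filter; length; foldr; allFin; cartesianProductWith)
import Data.List.Extrema as Extrema
open import Data.Nat.Base as ℕ using (ℕ; zero; suc)
import Data.Nat.Properties as ℕ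
open import Data.Product.Base using (_×_; _,_; proj₂; ∃; ∃₂)
open import Data.Vec.Base as Vec using (Vec; []; _∷_)
open import Level using (Level; _⊔_) renaming (suc to lsuc)
open import Relation.Binary.Bundles using (DecTotalOrder)
open import Relation.Binary.Core using (Rel)
open import Relation.Binary.Structures using (IsDecTotalOrder)
import Relation.Binary.Construct.NonStrictToStrict as NonStrictToStrict
open import Relation.Binary.PropositionalEquality.Core using (_≡_)
open import Relation.Nullary.Decidable.Core using (does; ¬?; _×-dec_)
open import Relation.Nullary.Negation.Core using (¬_)
open import Relation.Unary using (Pred; Decidable)

private
  variable
    b p : Level
    A B : Set b
    m n : ℕ

-- The axioms of ℝ other than completeness, which is not needed.  The order is
-- decidable, as it is for ℝ classically.
record ArchimedeanOrderedField a ℓ₁ ℓ₂ : Set (lsuc (a ⊔ ℓ₁ ⊔ ℓ₂)) where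
  field
    commutativeRing : CommutativeRing a ℓ₁

  open CommutativeRing commutativeRing public

  infix  4 _≤_
  infix  8 _⁻¹

  field
    _≤_             : Rel Carrier ℓ₂
    isDecTotalOrder : IsDecTotalOrder _≈_ _≤_
    0≉1             : ¬ 0# ≈ 1#
    -- The value of 0# ⁻¹ is left arbitrary.
    _⁻¹             : Carrier → Carrier
    ⁻¹-cong         : ∀ {x y} → x ≈ y → x ⁻¹ ≈ y ⁻¹
    ⁻¹-inverseʳ     : ∀ {x} → ¬ x ≈ 0# → x * x ⁻¹ ≈ 1#
    +-monoˡ-≤       : ∀ {x y} z → x ≤ y → x + z ≤ y + z
    *-nonneg        : ∀ {x y} → 0# ≤ x → 0# ≤ y → 0# ≤ x * y

    archimedean     : ∀ x → ∃ λ k → x ≤ RawMonoid._×_ +-rawMonoid k 1#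

  fromℕ : ℕ → Carrier
  fromℕ k = RawMonoid._×_ +-rawMonoid k 1#

  decTotalOrder : DecTotalOrder a ℓ₁ ℓ₂
  decTotalOrder = record { isDecTotalOrder = isDecTotalOrder }

  open DecTotalOrder decTotalOrder public using (totalOrder; _≤?_; _≟_)
  open NonStrictToStrict _≈_ _≤_ public using (_<_)

  infixl 7 _/_
  _/_ : Carrier → Carrier → Carrier
  x / y = x * y ⁻¹

-- Polynomials with coefficients in ℕ, constant term first.
Polynomial : Set
Polynomial = List ℕ

eval : Polynomial → ℕ → ℕ
eval []       x = 0
eval (a ∷ as) x = a ℕ.+ x ℕ.* eval as x

subsets : ∀ n → List (Subset n)
subsets zero    = [] ∷ []
subsets (suc n) = map (inside ∷_) (subsets n) ++ map (outside ∷_) (subsets n)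

module Optimization {a ℓ₁ ℓ₂} (K : ArchimedeanOrderedField a ℓ₁ ℓ₂) where
  open ArchimedeanOrderedField K
  open Extrema totalOrder using (max)

  ∑ : List B → (B → Carrier) → Carrier
  ∑ xs g = foldr _+_ 0# (map g xs)

  Vanishing : (ℕ → Carrier) → Set (a ⊔ ℓ₁ ⊔ ℓ₂)
  Vanishing ε = ∀ η → 0# < η → ∃ λ n₀ → ∀ n → n₀ ℕ.≤ n → - η ≤ ε n × ε n ≤ η

  SetFunction : ℕ → Set a
  SetFunction n = Subset n → Carrier

  marginal : SetFunction n → Subset n → Fin n → Carrier
  marginal f S e = f (S ∪ ⁅ e ⁆) - f S

  -- Multiplicative approximation fails without this: f(S) = 2 ∣ S ∣ - 1 has
  -- 1 - c = 2.
  Nonnegative : SetFunction n → Set ℓ₂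
  Nonnegative f = ∀ S → 0# ≤ f S

  Monotone : SetFunction n → Set ℓ₂
  Monotone f = ∀ S e → 0# ≤ marginal f S e

  Submodular : SetFunction n → Set ℓ₂
  Submodular f = ∀ S T e → S ⊆ T → marginal f T e ≤ marginal f S e

  curvatureRatio : SetFunction n → Fin n → Subset n → Carrier
  curvatureRatio f e S = marginal f (S ∖ e) e / f ⁅ e ⁆

  -- μ is the minimum of the ratios that are defined.
  IsMinimalRatio : SetFunction n → Carrier → Set (ℓ₁ ⊔ ℓ₂)
  IsMinimalRatio f μ =
    (∀ e S → ¬ f ⁅ e ⁆ ≈ 0# → μ ≤ curvatureRatio f e S) ×
    (∃₂ λ e S → ¬ f ⁅ e ⁆ ≈ 0# × μ ≈ curvatureRatio f e S)

  HasCurvature : SetFunction n → Carrier → Set (a ⊔ ℓ₁ ⊔ ℓ₂)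
  HasCurvature f c = ∃ λ μ → IsMinimalRatio f μ × c ≈ 1# - μ

  -- The maximum of f over the sets of size at most k; ∅ is one of them.
  optimum : SetFunction n → ℕ → Carrier
  optimum {n} f k = max (f ∅) (map f (filter (λ T → ∣ T ∣ ℕ.≤? k) (subsets n)))

  -- Finitely supported distributions, as lists of outcomes with their
  -- weights.  An outcome may be repeated.

  Distribution : Set b → Set (a ⊔ b)
  Distribution A = List (A × Carrier)

  Pr : Distribution A → {P : Pred A p} → Decidable P → Carrier
  Pr D P? = ∑ D λ (x , w) → if does (P? x) then w else 0#

  independent : Vec (Distribution A) n → Distribution (Vec A n)
  independent []       = ([] , 1#) ∷ []
  independent (D ∷ Ds) =
    cartesianProductWith (λ (x , v) (xs , w) → x ∷ xs , v * w) D (independent Ds)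

  iid : ∀ m → Distribution A → Distribution (Vec A m)
  iid m D = independent (Vec.replicate m D)

  bernoulli : Carrier → Distribution Side
  bernoulli q = (inside , q) ∷ (outside , 1# - q) ∷ []

  record ProductDistribution (n : ℕ) : Set (a ⊔ ℓ₂) where
    field
      inclusion : Vec Carrier n
      valid     : ∀ e → 0# ≤ Vec.lookup inclusion e × Vec.lookup inclusion e ≤ 1#

    distribution : Distribution (Subset n)
    distribution = independent (Vec.map bernoulli inclusion)

  record BoundedMarginals (P : Polynomial) (𝒟 : ProductDistribution n) : Set ℓ₂ where
    open ProductDistribution 𝒟
    bound : Carrier
    bound = 1# / fromℕ (eval P n)
    field
      positive : 0 ℕ.< eval P n
      in-lower  : ∀ e → bound ≤ Pr distribution (e ∈?_)
      in-upper  : ∀ e → Pr distribution (e ∈?_) ≤ 1# - bound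
      out-lower : ∀ e → bound ≤ Pr distribution (λ S → ¬? (e ∈? S))
      out-upper : ∀ e → Pr distribution (λ S → ¬? (e ∈? S)) ≤ 1# - bound

  Samples : ℕ → Set a
  Samples n = List (Subset n × Carrier)

  Algorithm : ℕ → Set a
  Algorithm n = Samples n → Subset n

  observe : SetFunction n → Vec (Subset n) m → Samples n
  observe f Ss = Vec.toList (Vec.map (λ S → S , f S) Ss)

  -- On an empty sample this has the arbitrary value 0# / 0#.
  average : Samples n → Carrier
  average σ = ∑ σ proj₂ / fromℕ (length σ)

  v̂ : Samples n → Fin n → Carrier
  v̂ σ i = average (filter (λ (S , _) → i ∈? S) σ)
         - average (filter (λ (S , _) → ¬? (i ∈? S)) σ)

  estimate : Samples n → Subset n → Carrier
  estimate {n} σ T = ∑ (filter (_∈? T) (allFin n)) (v̂ σ)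

  -- Ties in the arg max may be broken in any way.
  IsMaxMargCont : ℕ → Algorithm n → Set (a ⊔ ℓ₂)
  IsMaxMargCont k alg = ∀ σ →
    ∣ alg σ ∣ ≡ k × (∀ T → ∣ T ∣ ≡ k → estimate σ T ≤ estimate σ (alg σ))

  Approximates : SetFunction n → ℕ → Carrier → Subset n → Set ℓ₂
  Approximates f k α S = ∣ S ∣ ≡ k × α * optimum f k ≤ f S

  approximates? : (f : SetFunction n) (k : ℕ) (α : Carrier) → Decidable (Approximates f k α)
  approximates? f k α S = (∣ S ∣ ℕ.≟ k) ×-dec (α * optimum f k ≤? f S)

{-# OPTIONS --safe #-}
-- By independence the true contribution v i = E[f ∣ i ∈ S] - E[f ∣ i ∉ S] equals
-- the mean of f (S ∪ i) - f (S ∖ i), so (1 - c) f(i) ≤ v i ≤ f(i).  Summing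
-- marginals along a set, f(S) - f(∅) also lies between (1 - c) ∑ f(i) and ∑ f(i)
-- over i ∈ S.  Hence maximising ∑ v i loses a factor (1 - c)², and errors of θ in
-- the estimates cost another 2 k θ.
--
-- Sums are controlled by second moments.  Each of the 2 n averages is a quotient
-- of two sample sums, and U adds up the squared deviations of all of them from
-- their means.  A single use of Markov's inequality for U then serves in place of
-- a union bound.  All errors are measured in units of the optimum, which is
-- positive when k ≥ 1 and bounds f up to a factor n + 1.

module Submission where

open import Defs
open import Algebra.Solver.Ring.AlmostCommutativeRing using (_-Raw-AlmostCommutative⟶_; fromCommutativeRing)
open import Data.Bool.Base using (Bool; true; false; not; if_then_else_)
open import Data.Fin.Base using (Fin; zero; suc)
open import Data.Fin.Subset using (Subset; Side; inside; outside; ⁅_⁆; _∪_; ∣_∣) renaming (_-_ to _∖_; ⊥ to ∅)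
open import Data.Fin.Subset.Properties
  using (_∈?_; ∪-identityˡ; ∪-identityʳ; ⊥⊆; ∣⊥∣≡0; ∣⁅x⁆∣≡1; ∣p∣≤n; p─⊥≡p)
open import Data.Integer.Base as ℤ using (ℤ; +_; -[1+_])
import Data.Integer.Properties as ℤ
open import Data.List.Base as List using (List; []; _∷_; _++_; map; filter; allFin; cartesianProductWith)
import Data.List.Extrema as Extrema
open import Data.List.Membership.Propositional using () renaming (_∈_ to _∈ˡ_)
open import Data.List.Membership.Propositional.Properties
  using (∈-map⁺; ∈-map⁻; ∈-filter⁺; ∈-filter⁻; ∈-++⁺ˡ; ∈-++⁺ʳ)
import Data.List.Properties as List
import Data.List.Relation.Unary.All as All
open import Data.List.Relation.Unary.Any using (here)
open import Data.Maybe.Base as Maybe using (Maybe)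
open import Data.Nat.Base as ℕ using (ℕ; zero; suc)
import Data.Nat.Properties as ℕ
open import Data.Nat.Tactic.RingSolver using (solve-∀)
open import Data.Product.Base using (_×_; _,_; proj₁; proj₂; ∃; ∃₂)
import Data.Sign.Base as Sign
open import Data.Sum.Base using (inj₁; inj₂)
open import Data.Vec.Base as Vec using (Vec; []; _∷_; lookup; _[_]≔_)
import Data.Vec.Properties as Vec
open import Function.Base using (_∘_; id)
open import Level using (Level)
open import Relation.Binary.Bundles using (DecTotalOrder)
import Relation.Binary.PropositionalEquality as ≡
open ≡ using (_≡_; module ≡-Reasoning)
open import Relation.Nullary.Decidable using (Dec; yes; no; does; ¬?; dec⇒maybe)
open import Relation.Nullary.Negation using (¬_; contradiction)
open import Relation.Unary using (Pred; Decidable)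

-- The obstacle is that the two sub-samples behind `v̂` have random sizes, so an average is not a
-- sum of independent terms and its denominator may even be zero. Centring repairs this: with c the
-- conditional mean and q the probability of a side, the terms 𝟙 * (f - c) and 𝟙 - q have mean zero
-- over the whole i.i.d. sample. If both of their sums are small, the sub-sample has size at least m
-- / (2 L), and dividing the first sum by this size bounds the error of the average. Second moments
-- need only field operations, whereas exponential tail bounds would need an exponential. The price
-- is a sample size proportional to 1 / δ instead of its logarithm, harmless for a constant δ. The
-- constants: each average errs by at most O / R, with O the optimum and R = 4 (n + 1)², so `v̂`
-- errs by at most θ = 2 O / R. Then 2 k θ ≤ 4 (n + 1) O / R = O / (n + 1), whence the choice ε n =
-- 1 / (n + 1).

private
  variable
    b p : Level
    A B : Set b
    n : ℕ

-- Ring normalisation over the field, with integer coefficients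

module IntegerSolver {a ℓ₁ ℓ₂ : Level} (K : ArchimedeanOrderedField a ℓ₁ ℓ₂) where
  open ArchimedeanOrderedField K hiding (zero)
  open import Algebra.Properties.Ring ring
    using (-0#≈0#; -‿involutive; -‿+-comm; -‿distribˡ-*; -‿distribʳ-*)
  open import Algebra.Properties.Semiring.Mult.TCOptimised semiring
    using (1+×; ×-homo-+; ×1-homo-*) renaming (_×_ to _⊗_)
  open import Relation.Binary.Reasoning.Setoid setoid

  private
    -- Integer coefficients compute, so cancelling terms are recognised by evaluation, which the
    -- abstract decision procedure of `K` would not allow. The optimised multiple makes `con (+ 0)`
    -- and `con (+ 1)` evaluate to `0#` and `1#` by definition, so solved equations fit the goals
    -- verbatim.
    ⟦_⟧ : ℤ → Carrier
    ⟦ + n ⟧      = n ⊗ 1#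
    ⟦ -[1+ n ] ⟧ = - (suc n ⊗ 1#)

    signed : Sign.Sign → Carrier → Carrier
    signed Sign.+ x = x
    signed Sign.- x = - x

    ⟦◃⟧ : ∀ s n → ⟦ s ℤ.◃ n ⟧ ≈ signed s (n ⊗ 1#)
    ⟦◃⟧ Sign.+ zero    = refl
    ⟦◃⟧ Sign.- zero    = sym -0#≈0#
    ⟦◃⟧ Sign.+ (suc n) = refl
    ⟦◃⟧ Sign.- (suc n) = refl

    signed-cong : ∀ s {x y} → x ≈ y → signed s x ≈ signed s y
    signed-cong Sign.+ = λ eq → eq
    signed-cong Sign.- = -‿cong

    signed-* : ∀ s t x y → signed (s Sign.* t) (x * y) ≈ signed s x * signed t y
    signed-* Sign.+ Sign.+ x y = refl
    signed-* Sign.+ Sign.- x y = -‿distribʳ-* x y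
    signed-* Sign.- Sign.+ x y = -‿distribˡ-* x y
    signed-* Sign.- Sign.- x y = begin
      x * y        ≈⟨ -‿involutive (x * y) ⟨
      - - (x * y)  ≈⟨ -‿cong (-‿distribʳ-* x y) ⟩
      - (x * - y)  ≈⟨ -‿distribˡ-* x (- y) ⟩
      - x * - y    ∎

    ⟦⟧-signed : ∀ i → ⟦ i ⟧ ≈ signed (ℤ.sign i) (ℤ.∣ i ∣ ⊗ 1#)
    ⟦⟧-signed (+ n)      = refl
    ⟦⟧-signed -[1+ n ]   = refl

    -- Integer multiplication is defined through signs and absolute values, so both factors are
    -- brought to that form; what remains is a rule of signs and a product of natural multiples.
    *-homo : ∀ i j → ⟦ i ℤ.* j ⟧ ≈ ⟦ i ⟧ * ⟦ j ⟧
    *-homo i j = begin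
      ⟦ i ℤ.* j ⟧                                     ≈⟨ ⟦◃⟧ s (ℤ.∣ i ∣ ℕ.* ℤ.∣ j ∣) ⟩
      signed s ((ℤ.∣ i ∣ ℕ.* ℤ.∣ j ∣) ⊗ 1#)           ≈⟨ signed-cong s (×1-homo-* ℤ.∣ i ∣ ℤ.∣ j ∣) ⟩
      signed s ((ℤ.∣ i ∣ ⊗ 1#) * (ℤ.∣ j ∣ ⊗ 1#))      ≈⟨ signed-* (ℤ.sign i) (ℤ.sign j) _ _ ⟩
      signed (ℤ.sign i) (ℤ.∣ i ∣ ⊗ 1#) * signed (ℤ.sign j) (ℤ.∣ j ∣ ⊗ 1#)
                                                      ≈⟨ *-cong (⟦⟧-signed i) (⟦⟧-signed j) ⟨
      ⟦ i ⟧ * ⟦ j ⟧                                   ∎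
      where s = ℤ.sign i Sign.* ℤ.sign j

    x-0≈x : ∀ x → x - 0# ≈ x
    x-0≈x x = trans (+-congˡ -0#≈0#) (+-identityʳ x)

    ⊖-homo : ∀ m n → ⟦ m ℤ.⊖ n ⟧ ≈ m ⊗ 1# - n ⊗ 1#
    ⊖-homo zero    zero    = sym (x-0≈x 0#)
    ⊖-homo zero    (suc n) = sym (+-identityˡ _)
    ⊖-homo (suc m) zero    = sym (x-0≈x _)
    ⊖-homo (suc m) (suc n) = begin
      ⟦ suc m ℤ.⊖ suc n ⟧                    ≡⟨ ≡.cong ⟦_⟧ (ℤ.[1+m]⊖[1+n]≡m⊖n m n) ⟩
      ⟦ m ℤ.⊖ n ⟧                            ≈⟨ ⊖-homo m n ⟩
      m ⊗ 1# - n ⊗ 1#                        ≈⟨ +-identityˡ _ ⟨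
      0# + (m ⊗ 1# - n ⊗ 1#)                 ≈⟨ +-congʳ (-‿inverseʳ 1#) ⟨
      (1# - 1#) + (m ⊗ 1# - n ⊗ 1#)          ≈⟨ interchange 1# (- 1#) (m ⊗ 1#) (- (n ⊗ 1#)) ⟩
      (1# + m ⊗ 1#) + (- 1# - n ⊗ 1#)        ≈⟨ +-congˡ (-‿+-comm 1# (n ⊗ 1#)) ⟩
      (1# + m ⊗ 1#) - (1# + n ⊗ 1#)          ≈⟨ +-cong (1+× m 1#) (-‿cong (1+× n 1#)) ⟨
      suc m ⊗ 1# - suc n ⊗ 1#                ∎
      where open import Algebra.Properties.CommutativeSemigroup +-commutativeSemigroup using (interchange)

    +-homo : ∀ i j → ⟦ i ℤ.+ j ⟧ ≈ ⟦ i ⟧ + ⟦ j ⟧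
    +-homo (+ m)    (+ n)    = ×-homo-+ 1# m n
    +-homo (+ m)    -[1+ n ] = ⊖-homo m (suc n)
    +-homo -[1+ m ] (+ n)    = trans (⊖-homo n (suc m)) (+-comm _ _)
    +-homo -[1+ m ] -[1+ n ] = begin
      - (suc (suc (m ℕ.+ n)) ⊗ 1#)           ≡⟨ ≡.cong (λ k → - (suc k ⊗ 1#)) (ℕ.+-suc m n) ⟨
      - ((suc m ℕ.+ suc n) ⊗ 1#)             ≈⟨ -‿cong (×-homo-+ 1# (suc m) (suc n)) ⟩
      - (suc m ⊗ 1# + suc n ⊗ 1#)            ≈⟨ -‿+-comm (suc m ⊗ 1#) (suc n ⊗ 1#) ⟨
      - (suc m ⊗ 1#) - suc n ⊗ 1#            ∎

    -‿homo : ∀ i → ⟦ ℤ.- i ⟧ ≈ - ⟦ i ⟧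
    -‿homo (+ zero)   = sym -0#≈0#
    -‿homo (+ suc n)  = refl
    -‿homo -[1+ n ]   = sym (-‿involutive _)

    homomorphism : ℤ.+-*-rawRing -Raw-AlmostCommutative⟶ fromCommutativeRing commutativeRing
    homomorphism = record
      { ⟦_⟧    = ⟦_⟧
      ; +-homo = +-homo
      ; *-homo = *-homo
      ; -‿homo = -‿homo
      ; 0-homo = refl
      ; 1-homo = refl
      }

    coefficient≟ : ∀ i j → Maybe (⟦ i ⟧ ≈ ⟦ j ⟧)
    coefficient≟ i j = Maybe.map (λ { ≡.refl → refl }) (dec⇒maybe (i ℤ.≟ j))

  open import Algebra.Solver.Ring ℤ.+-*-rawRing (fromCommutativeRing commutativeRing)
    homomorphism coefficient≟ public using (solve; _:=_; _:+_; _:*_; _:-_; :-_; con)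

-- Consequences of the ordered field axioms

module OrderedFieldProperties {a ℓ₁ ℓ₂ : Level} (K : ArchimedeanOrderedField a ℓ₁ ℓ₂) where
  open ArchimedeanOrderedField K hiding (zero)
  open IntegerSolver K
  open import Algebra.Properties.Semiring.Mult semiring using (×-homo-+; ×1-homo-*)
  open import Algebra.Properties.Ring ring using (+-cancelˡ)
  open DecTotalOrder decTotalOrder public
    using (≤-respˡ-≈; ≤-respʳ-≈)
    renaming ( refl to ≤-refl; reflexive to ≤-reflexive; trans to ≤-trans; antisym to ≤-antisym
             ; total to ≤-total; poset to ≤-poset)
  open import Relation.Binary.Reasoning.PartialOrder ≤-poset

  ≰⇒> : ∀ {x y} → ¬ x ≤ y → y < x
  ≰⇒> {x} {y} x≰y with ≤-total x y
  ... | inj₁ x≤y = contradiction x≤y x≰y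
  ... | inj₂ y≤x = y≤x , λ y≈x → x≰y (≤-reflexive (sym y≈x))

  <⇒≱ : ∀ {x y} → x < y → ¬ y ≤ x
  <⇒≱ (x≤y , x≉y) y≤x = x≉y (≤-antisym x≤y y≤x)

  <-≤-trans : ∀ {x y z} → x < y → y ≤ z → x < z
  <-≤-trans {x} {y} {z} x<y y≤z = begin-strict
    x <⟨ x<y ⟩
    y ≤⟨ y≤z ⟩
    z ∎

  +-monoʳ-≤ : ∀ {x y} z → x ≤ y → z + x ≤ z + y
  +-monoʳ-≤ {x} {y} z x≤y = begin
    z + x ≈⟨ +-comm z x ⟩
    x + z ≤⟨ +-monoˡ-≤ z x≤y ⟩
    y + z ≈⟨ +-comm y z ⟩
    z + y ∎

  +-mono-≤ : ∀ {x y u v} → x ≤ y → u ≤ v → x + u ≤ y + v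
  +-mono-≤ x≤y u≤v = ≤-trans (+-monoˡ-≤ _ x≤y) (+-monoʳ-≤ _ u≤v)

  x≤y⇒0≤y-x : ∀ {x y} → x ≤ y → 0# ≤ y - x
  x≤y⇒0≤y-x {x} {y} x≤y = begin
    0#     ≈⟨ -‿inverseʳ x ⟨
    x - x  ≤⟨ +-monoˡ-≤ (- x) x≤y ⟩
    y - x  ∎

  0≤y-x⇒x≤y : ∀ {x y} → 0# ≤ y - x → x ≤ y
  0≤y-x⇒x≤y {x} {y} p = begin
    x           ≈⟨ +-identityˡ x ⟨
    0# + x      ≤⟨ +-monoˡ-≤ x p ⟩
    (y - x) + x ≈⟨ solve 2 (λ x y → (y :- x) :+ x := y) refl x y ⟩
    y           ∎

  -- Linear inequalities are proved by exhibiting the difference of the two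
  -- sides as a visibly nonnegative expression.
  ≤-by : ∀ {x y d} → 0# ≤ d → d ≈ y - x → x ≤ y
  ≤-by 0≤d eq = 0≤y-x⇒x≤y (≤-respʳ-≈ eq 0≤d)

  +-nonneg : ∀ {x y} → 0# ≤ x → 0# ≤ y → 0# ≤ x + y
  +-nonneg {x} {y} 0≤x 0≤y = ≤-respˡ-≈ (+-identityˡ 0#) (+-mono-≤ 0≤x 0≤y)

  neg-mono-≤ : ∀ {x y} → x ≤ y → - y ≤ - x
  neg-mono-≤ {x} {y} x≤y = ≤-by (x≤y⇒0≤y-x x≤y)
    (solve 2 (λ x y → y :- x := (:- x) :- (:- y)) refl x y)

  *-monoʳ-≤ : ∀ {x y z} → 0# ≤ z → x ≤ y → z * x ≤ z * y
  *-monoʳ-≤ {x} {y} {z} 0≤z x≤y = ≤-by (*-nonneg 0≤z (x≤y⇒0≤y-x x≤y))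
    (solve 3 (λ x y z → z :* (y :- x) := z :* y :- z :* x) refl x y z)

  *-monoˡ-≤ : ∀ {x y z} → 0# ≤ z → x ≤ y → x * z ≤ y * z
  *-monoˡ-≤ {x} {y} {z} 0≤z x≤y = begin
    x * z ≈⟨ *-comm x z ⟩
    z * x ≤⟨ *-monoʳ-≤ 0≤z x≤y ⟩
    z * y ≈⟨ *-comm z y ⟩
    y * z ∎

  *-mono-≤ : ∀ {x y u v} → 0# ≤ x → 0# ≤ v → x ≤ y → u ≤ v → x * u ≤ y * v
  *-mono-≤ 0≤x 0≤v x≤y u≤v = ≤-trans (*-monoʳ-≤ 0≤x u≤v) (*-monoˡ-≤ 0≤v x≤y)

  square-nonneg : ∀ x → 0# ≤ x * x
  square-nonneg x with ≤-total 0# x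
  ... | inj₁ 0≤x = *-nonneg 0≤x 0≤x
  ... | inj₂ x≤0 = ≤-respʳ-≈ (solve 1 (λ x → (con (+ 0) :- x) :* (con (+ 0) :- x) := x :* x) refl x)
                     (*-nonneg (x≤y⇒0≤y-x x≤0) (x≤y⇒0≤y-x x≤0))

  0≤1 : 0# ≤ 1#
  0≤1 = ≤-respʳ-≈ (*-identityˡ 1#) (square-nonneg 1#)

  0<1 : 0# < 1#
  0<1 = 0≤1 , 0≉1

  0<⇒≉0 : ∀ {x} → 0# < x → ¬ x ≈ 0#
  0<⇒≉0 (_ , 0≉x) x≈0 = 0≉x (sym x≈0)

  ⁻¹-inverseˡ : ∀ {x} → ¬ x ≈ 0# → x ⁻¹ * x ≈ 1#
  ⁻¹-inverseˡ x≉0 = trans (*-comm _ _) (⁻¹-inverseʳ x≉0)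

  *-positive : ∀ {x y} → 0# < x → 0# < y → 0# < x * y
  *-positive {x} {y} 0<x 0<y = *-nonneg (proj₁ 0<x) (proj₁ 0<y) , λ 0≈xy → proj₂ 0<y (begin-equality
    0#              ≈⟨ zeroʳ (x ⁻¹) ⟨
    x ⁻¹ * 0#       ≈⟨ *-congˡ 0≈xy ⟩
    x ⁻¹ * (x * y)  ≈⟨ *-assoc (x ⁻¹) x y ⟨
    x ⁻¹ * x * y    ≈⟨ *-congʳ (⁻¹-inverseˡ (0<⇒≉0 0<x)) ⟩
    1# * y          ≈⟨ *-identityˡ y ⟩
    y               ∎)

  -- If `y < x`, then `z * (x - y)` is positive, against the hypothesis. This stands in for
  -- division: bounds are proved after multiplication by a positive quantity, which keeps inverses
  -- out of the algebra.
  *-cancelˡ-≤ : ∀ {x y z} → 0# < z → z * x ≤ z * y → x ≤ y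
  *-cancelˡ-≤ {x} {y} {z} 0<z zx≤zy with x ≤? y
  ... | yes x≤y = x≤y
  ... | no  x≰y = contradiction zx≤zy (<⇒≱ (begin-strict
    z * y      ≈⟨ +-identityʳ _ ⟨
    z * y + 0# <⟨ +-monoʳ-≤ (z * y) (proj₁ 0<d) , (λ eq → proj₂ 0<d (cancel eq)) ⟩
    z * y + z * (x - y) ≈⟨ solve 3 (λ x y z → z :* y :+ z :* (x :- y) := z :* x) refl x y z ⟩
    z * x ∎))
    where
    y<x : y < x
    y<x = ≰⇒> x≰y
    0<x-y : 0# < x - y
    0<x-y = x≤y⇒0≤y-x (proj₁ y<x) , λ 0≈x-y → proj₂ y<x (begin-equality
      y            ≈⟨ +-identityˡ y ⟨
      0# + y       ≈⟨ +-congʳ 0≈x-y ⟩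
      (x - y) + y  ≈⟨ solve 2 (λ x y → (x :- y) :+ y := x) refl x y ⟩
      x            ∎)
    0<d : 0# < z * (x - y)
    0<d = *-positive 0<z 0<x-y
    cancel : z * y + 0# ≈ z * y + z * (x - y) → 0# ≈ z * (x - y)
    cancel = +-cancelˡ (z * y) 0# (z * (x - y))

  ⁻¹-nonneg : ∀ {x} → 0# < x → 0# ≤ x ⁻¹
  ⁻¹-nonneg {x} 0<x = *-cancelˡ-≤ 0<x (begin
    x * 0#    ≈⟨ zeroʳ x ⟩
    0#        ≤⟨ 0≤1 ⟩
    1#        ≈⟨ ⁻¹-inverseʳ (0<⇒≉0 0<x) ⟨
    x * x ⁻¹  ∎)

  x*[y/x]≈y : ∀ {x} y → ¬ x ≈ 0# → x * (y / x) ≈ y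
  x*[y/x]≈y {x} y x≉0 = begin-equality
    x * (y * x ⁻¹)  ≈⟨ solve 3 (λ x y z → x :* (y :* z) := y :* (x :* z)) refl x y (x ⁻¹) ⟩
    y * (x * x ⁻¹)  ≈⟨ *-congˡ (⁻¹-inverseʳ x≉0) ⟩
    y * 1#          ≈⟨ *-identityʳ y ⟩
    y               ∎

  infix 4 ∣_∣≤_
  -- A two-sided bound in place of an absolute value: each half is an ordinary linear inequality.
  ∣_∣≤_ : Carrier → Carrier → Set ℓ₂
  ∣ x ∣≤ y = - y ≤ x × x ≤ y

  -- Comparing squares replaces the square root when a bound on a squared sum is turned back into a
  -- bound on the sum.
  x²≤t²⇒x≤t : ∀ {x t} → 0# ≤ t → x * x ≤ t * t → x ≤ t
  x²≤t²⇒x≤t {x} {t} 0≤t x²≤t² with x ≤? t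
  ... | yes x≤t = x≤t
  ... | no  x≰t = *-cancelˡ-≤ 0<x (begin
    x * x  ≤⟨ x²≤t² ⟩
    t * t  ≤⟨ *-monoˡ-≤ 0≤t (proj₁ (≰⇒> x≰t)) ⟩
    x * t  ∎)
    where
    0<x : 0# < x
    0<x = begin-strict
      0# ≤⟨ 0≤t ⟩
      t  <⟨ ≰⇒> x≰t ⟩
      x  ∎

  x²≤t²⇒∣x∣≤t : ∀ {x t} → 0# ≤ t → x * x ≤ t * t → ∣ x ∣≤ t
  x²≤t²⇒∣x∣≤t {x} {t} 0≤t x²≤t² = ≤-by (x≤y⇒0≤y-x -x≤t) (solve 2 (λ x t → t :- (:- x) := x :- (:- t)) refl x t)
                                , x²≤t²⇒x≤t 0≤t x²≤t²
    where
    -x≤t : - x ≤ t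
    -x≤t = x²≤t²⇒x≤t 0≤t (≤-respˡ-≈ (solve 1 (λ x → x :* x := (:- x) :* (:- x)) refl x) x²≤t²)

  ∣x∣≤t⇒x²≤t² : ∀ {x t} → ∣ x ∣≤ t → x * x ≤ t * t
  ∣x∣≤t⇒x²≤t² {x} {t} (-t≤x , x≤t) = ≤-by (*-nonneg (x≤y⇒0≤y-x -t≤x) (x≤y⇒0≤y-x x≤t))
    (solve 2 (λ x t → (x :- (:- t)) :* (t :- x) := t :* t :- x :* x) refl x t)

  fromℕ-+ : ∀ m n → fromℕ (m ℕ.+ n) ≈ fromℕ m + fromℕ n
  fromℕ-+ = ×-homo-+ 1#

  fromℕ-* : ∀ m n → fromℕ (m ℕ.* n) ≈ fromℕ m * fromℕ n
  fromℕ-* = ×1-homo-*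

  fromℕ-nonneg : ∀ n → 0# ≤ fromℕ n
  fromℕ-nonneg zero    = ≤-refl
  fromℕ-nonneg (suc n) = +-nonneg 0≤1 (fromℕ-nonneg n)

  fromℕ-mono-≤ : ∀ {m n} → m ℕ.≤ n → fromℕ m ≤ fromℕ n
  fromℕ-mono-≤ {n = n} ℕ.z≤n = fromℕ-nonneg n
  fromℕ-mono-≤ (ℕ.s≤s m≤n)   = +-monoʳ-≤ 1# (fromℕ-mono-≤ m≤n)

  fromℕ-positive : ∀ {n} → 0 ℕ.< n → 0# < fromℕ n
  fromℕ-positive {n} 0<n = <-≤-trans 0<1 (begin
    1#       ≈⟨ +-identityʳ 1# ⟨
    fromℕ 1  ≤⟨ fromℕ-mono-≤ 0<n ⟩
    fromℕ n  ∎)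

-- Finite sums, expectations and second moments

module Expectation {a ℓ₁ ℓ₂ : Level} (K : ArchimedeanOrderedField a ℓ₁ ℓ₂) where
  open ArchimedeanOrderedField K hiding (zero)
  open Optimization K
  open IntegerSolver K
  open OrderedFieldProperties K
  open import Relation.Binary.Reasoning.PartialOrder ≤-poset

  ∑-cong : ∀ (xs : List A) {g h : A → Carrier} → (∀ x → g x ≈ h x) → ∑ xs g ≈ ∑ xs h
  ∑-cong []       eq = refl
  ∑-cong (x ∷ xs) eq = +-cong (eq x) (∑-cong xs eq)

  ∑-mono : ∀ (xs : List A) {g h : A → Carrier} → (∀ x → g x ≤ h x) → ∑ xs g ≤ ∑ xs h
  ∑-mono []       le = ≤-refl
  ∑-mono (x ∷ xs) le = +-mono-≤ (le x) (∑-mono xs le)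

  ∑-zero : ∀ (xs : List A) → ∑ xs (λ _ → 0#) ≈ 0#
  ∑-zero []       = refl
  ∑-zero (x ∷ xs) = trans (+-identityˡ _) (∑-zero xs)

  ∑-const : ∀ (xs : List A) c → ∑ xs (λ _ → c) ≈ fromℕ (List.length xs) * c
  ∑-const []       c = sym (zeroˡ c)
  ∑-const (x ∷ xs) c = trans (+-congˡ (∑-const xs c))
    (solve 2 (λ c k → c :+ k :* c := (con (+ 1) :+ k) :* c) refl c (fromℕ (List.length xs)))

  ∑-nonneg : ∀ (xs : List A) {g : A → Carrier} → (∀ x → 0# ≤ g x) → 0# ≤ ∑ xs g
  ∑-nonneg xs 0≤g = ≤-respˡ-≈ (∑-zero xs) (∑-mono xs 0≤g)

  ∑-+ : ∀ (xs : List A) (g h : A → Carrier) → ∑ xs (λ x → g x + h x) ≈ ∑ xs g + ∑ xs h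
  ∑-+ []       g h = sym (+-identityˡ 0#)
  ∑-+ (x ∷ xs) g h = begin-equality
    g x + h x + ∑ xs (λ x → g x + h x)  ≈⟨ +-congˡ (∑-+ xs g h) ⟩
    g x + h x + (∑ xs g + ∑ xs h)
      ≈⟨ solve 4 (λ p q r s → p :+ q :+ (r :+ s) := p :+ r :+ (q :+ s)) refl (g x) (h x) (∑ xs g) (∑ xs h) ⟩
    g x + ∑ xs g + (h x + ∑ xs h)       ∎

  ∑-*ˡ : ∀ (xs : List A) c (g : A → Carrier) → ∑ xs (λ x → c * g x) ≈ c * ∑ xs g
  ∑-*ˡ []       c g = sym (zeroʳ c)
  ∑-*ˡ (x ∷ xs) c g = trans (+-congˡ (∑-*ˡ xs c g)) (sym (distribˡ c _ _))

  ∑-- : ∀ (xs : List A) (g h : A → Carrier) → ∑ xs (λ x → g x - h x) ≈ ∑ xs g - ∑ xs h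
  ∑-- xs g h = begin-equality
    ∑ xs (λ x → g x - h x)         ≈⟨ ∑-cong xs (λ x → solve 2 (λ g h → g :- h := g :+ (:- con (+ 1)) :* h) refl (g x) (h x)) ⟩
    ∑ xs (λ x → g x + - 1# * h x)  ≈⟨ trans (∑-+ xs g _) (+-congˡ (∑-*ˡ xs (- 1#) h)) ⟩
    ∑ xs g + - 1# * ∑ xs h         ≈⟨ solve 2 (λ g h → g :+ (:- con (+ 1)) :* h := g :- h) refl (∑ xs g) (∑ xs h) ⟩
    ∑ xs g - ∑ xs h                ∎

  ∑-++ : ∀ (xs ys : List A) (g : A → Carrier) → ∑ (xs ++ ys) g ≈ ∑ xs g + ∑ ys g
  ∑-++ []       ys g = sym (+-identityˡ _)
  ∑-++ (x ∷ xs) ys g = trans (+-congˡ (∑-++ xs ys g)) (sym (+-assoc _ _ _))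

  ∑-map : ∀ (xs : List A) (φ : A → B) (g : B → Carrier) → ∑ (map φ xs) g ≈ ∑ xs (g ∘ φ)
  ∑-map []       φ g = refl
  ∑-map (x ∷ xs) φ g = +-congˡ (∑-map xs φ g)

  ∑-filter : ∀ {P : Pred A p} (P? : Decidable P) xs (g : A → Carrier) →
             ∑ (List.filter P? xs) g ≈ ∑ xs (λ x → if does (P? x) then g x else 0#)
  ∑-filter P? []       g = refl
  ∑-filter P? (x ∷ xs) g with does (P? x)
  ... | true  = +-congˡ (∑-filter P? xs g)
  ... | false = trans (∑-filter P? xs g) (sym (+-identityˡ _))

  𝟙 : Bool → Carrier
  𝟙 c = if c then 1# else 0#

  E : Distribution A → (A → Carrier) → Carrier
  E D g = ∑ D λ (x , w) → w * g x

  E-cong : ∀ (D : Distribution A) {g h} → (∀ x → g x ≈ h x) → E D g ≈ E D h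
  E-cong D eq = ∑-cong D (λ (x , w) → *-congˡ (eq x))

  E-+ : ∀ (D : Distribution A) g h → E D (λ x → g x + h x) ≈ E D g + E D h
  E-+ D g h = trans (∑-cong D (λ (x , w) → distribˡ w (g x) (h x))) (∑-+ D _ _)

  E-*ˡ : ∀ (D : Distribution A) c g → E D (λ x → c * g x) ≈ c * E D g
  E-*ˡ D c g = trans
    (∑-cong D (λ (x , w) → solve 3 (λ w c g → w :* (c :* g) := c :* (w :* g)) refl w c (g x)))
    (∑-*ˡ D c _)

  E-- : ∀ (D : Distribution A) g h → E D (λ x → g x - h x) ≈ E D g - E D h
  E-- D g h = trans
    (∑-cong D (λ (x , w) → solve 3 (λ w g h → w :* (g :- h) := w :* g :- w :* h) refl w (g x) (h x)))
    (∑-- D _ _)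

  E-∑ : ∀ (D : Distribution A) (is : List B) (g : B → A → Carrier) →
        E D (λ x → ∑ is (λ i → g i x)) ≈ ∑ is (λ i → E D (g i))
  E-∑ D []       g = trans (∑-cong D (λ (x , w) → zeroʳ w)) (∑-zero D)
  E-∑ D (i ∷ is) g = trans (E-+ D (g i) _) (+-congˡ (E-∑ D is g))

  Pr≈E : ∀ (D : Distribution A) {P : Pred A p} (P? : Decidable P) → Pr D P? ≈ E D (𝟙 ∘ does ∘ P?)
  Pr≈E D P? = ∑-cong D λ (x , w) → if-* (does (P? x)) w
    where
    if-* : ∀ c w → (if c then w else 0#) ≈ w * 𝟙 c
    if-* true  w = sym (*-identityʳ w)
    if-* false w = sym (zeroʳ w)

  -- Fubini for one factor against the rest. The facts about product and i.i.d. distributions rest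
  -- on this identity.
  E-independent : ∀ (D : Distribution A) (Ds : Vec (Distribution A) n) h →
    E (independent (D ∷ Ds)) h ≈ E D (λ x → E (independent Ds) (λ xs → h (x ∷ xs)))
  E-independent {A = A} {n = n} D Ds h = go D
    where
    weigh : A × Carrier → Vec A n × Carrier → Vec A (suc n) × Carrier
    weigh (x , v) (xs , w) = x ∷ xs , v * w
    go : ∀ D → E (cartesianProductWith weigh D (independent Ds)) h
               ≈ E D (λ x → E (independent Ds) (λ xs → h (x ∷ xs)))
    go []            = refl
    go ((x , v) ∷ D) = begin-equality
      E (map (weigh (x , v)) (independent Ds) ++ cartesianProductWith weigh D (independent Ds)) h
        ≈⟨ ∑-++ (map (weigh (x , v)) (independent Ds)) _ _ ⟩
      E (map (weigh (x , v)) (independent Ds)) h + E (cartesianProductWith weigh D (independent Ds)) h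
        ≈⟨ +-cong (∑-map (independent Ds) (weigh (x , v)) _) (go D) ⟩
      ∑ (independent Ds) (λ (xs , w) → v * w * h (x ∷ xs)) + rest
        ≈⟨ +-congʳ (∑-cong (independent Ds) (λ (xs , w) → *-assoc v w (h (x ∷ xs)))) ⟩
      ∑ (independent Ds) (λ (xs , w) → v * (w * h (x ∷ xs))) + rest
        ≈⟨ +-congʳ (∑-*ˡ (independent Ds) v _) ⟩
      v * E (independent Ds) (λ xs → h (x ∷ xs)) + rest ∎
      where rest = E D (λ x → E (independent Ds) (λ xs → h (x ∷ xs)))

  -- Positivity is asked of the expectation as a functional, not of single weights. In this form it
  -- passes to products through `E-independent` without inspecting the list of outcomes.
  record IsProbability {b : Level} {A : Set b} (D : Distribution A) : Set (a Level.⊔ ℓ₁ Level.⊔ ℓ₂ Level.⊔ b) where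
    field
      E-nonneg : ∀ g → (∀ x → 0# ≤ g x) → 0# ≤ E D g
      E-1      : E D (λ _ → 1#) ≈ 1#

    E-mono : ∀ {g h} → (∀ x → g x ≤ h x) → E D g ≤ E D h
    E-mono {g} {h} g≤h = ≤-by (E-nonneg (λ x → h x - g x) (λ x → x≤y⇒0≤y-x (g≤h x))) (E-- D h g)

    E-const : ∀ c → E D (λ _ → c) ≈ c
    E-const c = begin-equality
      E D (λ _ → c)       ≈⟨ E-cong D (λ _ → *-identityʳ c) ⟨
      E D (λ _ → c * 1#)  ≈⟨ E-*ˡ D c (λ _ → 1#) ⟩
      c * E D (λ _ → 1#)  ≈⟨ *-congˡ E-1 ⟩
      c * 1#              ≈⟨ *-identityʳ c ⟩
      c                   ∎

    -- Integrate the pointwise bound t * (1 - 𝟙) ≤ U. The large values of `U` are tied to the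
    -- failure of `P` because `P` will be the event of success.
    markov : ∀ {P : Pred A p} (P? : Decidable P) (U : A → Carrier) t →
             (∀ x → 0# ≤ U x) → (∀ x → ¬ P x → t ≤ U x) → t * (1# - Pr D P?) ≤ E D U
    markov P? U t 0≤U t≤U = begin
      t * (1# - Pr D P?)
        ≈⟨ *-congˡ (+-cong E-1 (-‿cong (sym (Pr≈E D P?)))) ⟨
      t * (E D (λ _ → 1#) - E D (𝟙 ∘ does ∘ P?))
        ≈⟨ *-congˡ (E-- D _ _) ⟨
      t * E D (λ x → 1# - 𝟙 (does (P? x)))
        ≈⟨ E-*ˡ D t _ ⟨
      E D (λ x → t * (1# - 𝟙 (does (P? x))))
        ≤⟨ E-mono bound ⟩
      E D U ∎
      where
      bound : ∀ x → t * (1# - 𝟙 (does (P? x))) ≤ U x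
      bound x with P? x
      ... | yes _ = ≤-respˡ-≈ (solve 1 (λ t → con (+ 0) := t :* (con (+ 1) :- con (+ 1))) refl t) (0≤U x)
      ... | no ¬p = ≤-respˡ-≈ (solve 1 (λ t → t := t :* (con (+ 1) :- con (+ 0))) refl t) (t≤U x ¬p)

  independent-isProbability : (Ds : Vec (Distribution A) n) →
    (∀ i → IsProbability (Vec.lookup Ds i)) → IsProbability (independent Ds)
  independent-isProbability []       _    = record
    { E-nonneg = λ g 0≤g → ≤-respʳ-≈ (solve 1 (λ x → x := con (+ 1) :* x :+ con (+ 0)) refl (g [])) (0≤g [])
    ; E-1      = solve 0 (con (+ 1) :* con (+ 1) :+ con (+ 0) := con (+ 1)) refl
    }
  independent-isProbability (D ∷ Ds) prob = record
    { E-nonneg = λ g 0≤g → ≤-respʳ-≈ (sym (E-independent D Ds g))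
        (Head.E-nonneg _ λ x → Tail.E-nonneg _ λ xs → 0≤g (x ∷ xs))
    ; E-1      = trans (E-independent D Ds _) (trans (E-cong D (λ _ → Tail.E-1)) Head.E-1)
    }
    where
    module Head = IsProbability (prob zero)
    module Tail = IsProbability (independent-isProbability Ds (λ i → prob (suc i)))

  iid-isProbability : ∀ m {D : Distribution A} → IsProbability D → IsProbability (iid m D)
  iid-isProbability m {D} prob = independent-isProbability (Vec.replicate m D)
    (λ i → ≡.subst IsProbability (≡.sym (Vec.lookup-replicate i D)) prob)

  module _ {D : Distribution A} (D-prob : IsProbability D) {g : A → Carrier} (centred : E D g ≈ 0#) where
    open IsProbability

    private
      S : ∀ {m} → Vec A m → Carrier
      S xs = ∑ (Vec.toList xs) g

    E-iid-sum : ∀ m → E (iid m D) S ≈ 0#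
    E-iid-sum zero    = solve 0 (con (+ 1) :* con (+ 0) :+ con (+ 0) := con (+ 0)) refl
    E-iid-sum (suc m) = begin-equality
      E (iid (suc m) D) S                          ≈⟨ E-independent D (Vec.replicate m D) _ ⟩
      E D (λ x → E (iid m D) (λ xs → g x + S xs))  ≈⟨ E-cong D (λ x → trans (E-+ (iid m D) _ _)
                                                        (+-cong (E-const (iid-isProbability m D-prob) (g x)) (E-iid-sum m))) ⟩
      E D (λ x → g x + 0#)                         ≈⟨ E-cong D (λ x → +-identityʳ (g x)) ⟩
      E D g                                        ≈⟨ centred ⟩
      0#                                           ∎

    -- Variances of independent centred terms add up: when the square is expanded, the cross term
    -- carries the mean of the remaining sum, which is zero by `E-iid-sum`.
    E-iid-sum² : ∀ m → E (iid m D) (λ xs → S xs * S xs) ≈ fromℕ m * E D (λ x → g x * g x)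
    E-iid-sum² zero    = trans (solve 0 (con (+ 1) :* (con (+ 0) :* con (+ 0)) :+ con (+ 0) := con (+ 0)) refl) (sym (zeroˡ _))
    E-iid-sum² (suc m) = begin-equality
      E (iid (suc m) D) (λ xs → S xs * S xs)
        ≈⟨ E-independent D (Vec.replicate m D) _ ⟩
      E D (λ x → E (iid m D) (λ xs → (g x + S xs) * (g x + S xs)))
        ≈⟨ E-cong D expand ⟩
      E D (λ x → g x * g x + fromℕ m * v)
        ≈⟨ trans (E-+ D _ _) (+-congˡ (E-const D-prob _)) ⟩
      v + fromℕ m * v
        ≈⟨ solve 2 (λ v m → v :+ m :* v := (con (+ 1) :+ m) :* v) refl v (fromℕ m) ⟩
      fromℕ (suc m) * v ∎
      where
      v : Carrier
      v = E D (λ x → g x * g x)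
      expand : ∀ x → E (iid m D) (λ xs → (g x + S xs) * (g x + S xs)) ≈ g x * g x + fromℕ m * v
      expand x = begin-equality
        E (iid m D) (λ xs → (g x + S xs) * (g x + S xs))
          ≈⟨ E-cong (iid m D) (λ xs → solve 2 (λ g s → (g :+ s) :* (g :+ s) := g :* g :+ ((g :+ g) :* s :+ s :* s)) refl (g x) (S xs)) ⟩
        E (iid m D) (λ xs → g x * g x + ((g x + g x) * S xs + S xs * S xs))
          ≈⟨ trans (E-+ (iid m D) _ _) (+-congˡ (trans (E-+ (iid m D) _ _) (+-congʳ (E-*ˡ (iid m D) (g x + g x) _)))) ⟩
        E (iid m D) (λ xs → g x * g x) + ((g x + g x) * E (iid m D) S + E (iid m D) (λ xs → S xs * S xs))
          ≈⟨ +-cong (E-const (iid-isProbability m D-prob) _) (+-cong (*-congˡ (E-iid-sum m)) (E-iid-sum² m)) ⟩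
        g x * g x + ((g x + g x) * 0# + fromℕ m * v)
          ≈⟨ solve 2 (λ g w → g :* g :+ ((g :+ g) :* con (+ 0) :+ w) := g :* g :+ w) refl (g x) (fromℕ m * v) ⟩
        g x * g x + fromℕ m * v ∎

-- Set operations as updates of the characteristic vector

∪-⁅⁆ : ∀ (S : Subset n) i → S ∪ ⁅ i ⁆ ≡ S [ i ]≔ inside
∪-⁅⁆ (inside  ∷ S) zero    = ≡.cong (inside ∷_) (∪-identityʳ S)
∪-⁅⁆ (outside ∷ S) zero    = ≡.cong (inside ∷_) (∪-identityʳ S)
∪-⁅⁆ (inside  ∷ S) (suc i) = ≡.cong (inside ∷_) (∪-⁅⁆ S i)
∪-⁅⁆ (outside ∷ S) (suc i) = ≡.cong (outside ∷_) (∪-⁅⁆ S i)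

∖-update : ∀ (S : Subset n) i → S ∖ i ≡ S [ i ]≔ outside
∖-update (s ∷ S) zero          = ≡.cong (outside ∷_) (p─⊥≡p S)
∖-update (inside  ∷ S) (suc i) = ≡.cong (inside ∷_) (∖-update S i)
∖-update (outside ∷ S) (suc i) = ≡.cong (outside ∷_) (∖-update S i)

∖-∪-⁅⁆ : ∀ (S : Subset n) i → (S ∖ i) ∪ ⁅ i ⁆ ≡ S [ i ]≔ inside
∖-∪-⁅⁆ S i = ≡.trans (∪-⁅⁆ (S ∖ i) i)
  (≡.trans (≡.cong (_[ i ]≔ inside) (∖-update S i)) (Vec.[]≔-idempotent S i))

∈-subsets : ∀ (S : Subset n) → S ∈ˡ subsets n
∈-subsets []            = here ≡.refl
∈-subsets (inside  ∷ S) = ∈-++⁺ˡ (∈-map⁺ (inside ∷_) (∈-subsets S))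
∈-subsets (outside ∷ S) = ∈-++⁺ʳ (map (inside ∷_) (subsets _)) (∈-map⁺ (outside ∷_) (∈-subsets S))

∣S∣≡0⇒S≡∅ : ∀ (S : Subset n) → ∣ S ∣ ≡ 0 → S ≡ ∅
∣S∣≡0⇒S≡∅ []            eq = ≡.refl
∣S∣≡0⇒S≡∅ (outside ∷ S) eq = ≡.cong (outside ∷_) (∣S∣≡0⇒S≡∅ S eq)

-- Spelled with the two tests that v̂ uses to split its sample.
hasSide : Fin n → Side → Subset n → Bool
hasSide i inside  S = does (i ∈? S)
hasSide i outside S = does (¬? (i ∈? S))

hasSide-refl : ∀ (i : Fin n) s S → hasSide i s (S [ i ]≔ s) ≡ true
hasSide-refl zero    inside  (_ ∷ S)       = ≡.refl
hasSide-refl zero    outside (_ ∷ S)       = ≡.refl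
hasSide-refl (suc i) inside  (_ ∷ S)       = hasSide-refl i inside S
hasSide-refl (suc i) outside (_ ∷ S)       = hasSide-refl i outside S

hasSide-not : ∀ (i : Fin n) s S → hasSide i s (S [ i ]≔ not s) ≡ false
hasSide-not zero    inside  (_ ∷ S)       = ≡.refl
hasSide-not zero    outside (_ ∷ S)       = ≡.refl
hasSide-not (suc i) inside  (_ ∷ S)       = hasSide-not i inside S
hasSide-not (suc i) outside (_ ∷ S)       = hasSide-not i outside S

-- Conditioning a product distribution on one element

module ProductDistributionProperties {a ℓ₁ ℓ₂ : Level} (K : ArchimedeanOrderedField a ℓ₁ ℓ₂) where
  open ArchimedeanOrderedField K hiding (zero)
  open Optimization K
  open IntegerSolver K
  open OrderedFieldProperties K
  open Expectation K
  open IsProbability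
  open import Relation.Binary.Reasoning.PartialOrder ≤-poset

  weight : Carrier → Side → Carrier
  weight q inside  = q
  weight q outside = 1# - q

  E-bernoulli : ∀ q g → E (bernoulli q) g ≈ q * g inside + (1# - q) * g outside
  E-bernoulli q g = +-congˡ (+-identityʳ _)

  bernoulli-isProbability : ∀ {q} → 0# ≤ q → q ≤ 1# → IsProbability (bernoulli q)
  bernoulli-isProbability {q} 0≤q q≤1 = record
    { E-nonneg = λ g 0≤g → ≤-respʳ-≈ (sym (E-bernoulli q g))
        (+-nonneg (*-nonneg 0≤q (0≤g inside)) (*-nonneg (x≤y⇒0≤y-x q≤1) (0≤g outside)))
    ; E-1 = trans (E-bernoulli q (λ _ → 1#))
        (solve 1 (λ q → q :* con (+ 1) :+ (con (+ 1) :- q) :* con (+ 1) := con (+ 1)) refl q)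
    }

  private
    valid-isProbability : ∀ (qs : Vec Carrier n) → (∀ i → 0# ≤ lookup qs i × lookup qs i ≤ 1#) →
                          ∀ i → IsProbability (lookup (Vec.map bernoulli qs) i)
    valid-isProbability qs valid i = ≡.subst IsProbability (≡.sym (Vec.lookup-map i bernoulli qs))
      (bernoulli-isProbability (proj₁ (valid i)) (proj₂ (valid i)))

  -- Under a product distribution coordinate `i` can be drawn last. Overwriting it leaves an
  -- integrand that ignores the original coordinate, whose own factor then integrates to one.
  E-resample : ∀ (qs : Vec Carrier n) → (∀ i → 0# ≤ lookup qs i × lookup qs i ≤ 1#) → ∀ i h →
    let D = independent (Vec.map bernoulli qs) in
    E D h ≈ lookup qs i * E D (λ S → h (S [ i ]≔ inside)) + (1# - lookup qs i) * E D (λ S → h (S [ i ]≔ outside))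
  E-resample (q ∷ qs) valid zero h = begin-equality
    E D h
      ≈⟨ E-independent (bernoulli q) (Vec.map bernoulli qs) h ⟩
    E (bernoulli q) (λ s → E D′ (λ S → h (s ∷ S)))
      ≈⟨ E-bernoulli q (λ s → E D′ (λ S → h (s ∷ S))) ⟩
    q * E D′ (λ S → h (inside ∷ S)) + (1# - q) * E D′ (λ S → h (outside ∷ S))
      ≈⟨ +-cong (*-congˡ (ignore inside)) (*-congˡ (ignore outside)) ⟨
    q * E D (λ S → h (S [ zero ]≔ inside)) + (1# - q) * E D (λ S → h (S [ zero ]≔ outside)) ∎
    where
    D = independent (Vec.map bernoulli (q ∷ qs))
    D′ = independent (Vec.map bernoulli qs)
    ignore : ∀ t → E D (λ S → h (S [ zero ]≔ t)) ≈ E D′ (λ S → h (t ∷ S))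
    ignore t = trans (E-independent (bernoulli q) (Vec.map bernoulli qs) _)
      (E-const (bernoulli-isProbability (proj₁ (valid zero)) (proj₂ (valid zero))) _)
  E-resample (q ∷ qs) valid (suc i) h = begin-equality
    E D h
      ≈⟨ E-independent β (Vec.map bernoulli qs) h ⟩
    E β (λ s → E D′ (λ S → h (s ∷ S)))
      ≈⟨ E-cong β (λ s → E-resample qs (λ j → valid (suc j)) i (λ S → h (s ∷ S))) ⟩
    E β (λ s → r * tail inside s + (1# - r) * tail outside s)
      ≈⟨ trans (E-+ β (λ s → r * tail inside s) (λ s → (1# - r) * tail outside s))
               (+-cong (E-*ˡ β r (tail inside)) (E-*ˡ β (1# - r) (tail outside))) ⟩
    r * E β (tail inside) + (1# - r) * E β (tail outside)
      ≈⟨ +-cong (*-congˡ (E-independent β (Vec.map bernoulli qs) _)) (*-congˡ (E-independent β (Vec.map bernoulli qs) _)) ⟨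
    r * E D (λ S → h (S [ suc i ]≔ inside)) + (1# - r) * E D (λ S → h (S [ suc i ]≔ outside)) ∎
    where
    r = lookup qs i
    β = bernoulli q
    D = independent (Vec.map bernoulli (q ∷ qs))
    D′ = independent (Vec.map bernoulli qs)
    tail : Side → Side → Carrier
    tail t s = E D′ (λ S → h (s ∷ (S [ i ]≔ t)))

  module _ (𝒟 : ProductDistribution n) where
    open ProductDistribution 𝒟

    distribution-isProbability : IsProbability distribution
    distribution-isProbability = independent-isProbability (Vec.map bernoulli inclusion) (valid-isProbability inclusion valid)

    -- Resampling `i` splits the expectation in two; the indicator is constantly one on the half
    -- where `i` is put on side `s` and constantly zero on the other.
    E-hasSide : ∀ i s (h : Subset n → Carrier) → E distribution (λ S → 𝟙 (hasSide i s S) * h S)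
                         ≈ weight (lookup inclusion i) s * E distribution (λ S → h (S [ i ]≔ s))
    E-hasSide i s h = trans (E-resample inclusion valid i g) (collect s ≡.refl)
      where
      q = lookup inclusion i
      g : Subset n → Carrier
      g S = 𝟙 (hasSide i s S) * h S
      kept : E distribution (λ S → g (S [ i ]≔ s)) ≈ E distribution (λ S → h (S [ i ]≔ s))
      kept = E-cong distribution λ S →
        trans (*-congʳ (reflexive (≡.cong 𝟙 (hasSide-refl i s S)))) (*-identityˡ (h (S [ i ]≔ s)))
      dropped : E distribution (λ S → g (S [ i ]≔ not s)) ≈ 0#
      dropped = trans
        (E-cong distribution λ S → trans (*-congʳ (reflexive (≡.cong 𝟙 (hasSide-not i s S)))) (zeroˡ (h (S [ i ]≔ not s))))
        (E-const distribution-isProbability 0#)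
      -- Matching on an equation instead of on `s` lets `kept` and `dropped`, proved once for `s`,
      -- serve both cases.
      collect : ∀ t → s ≡ t →
        q * E distribution (λ S → g (S [ i ]≔ inside)) + (1# - q) * E distribution (λ S → g (S [ i ]≔ outside))
          ≈ weight q s * E distribution (λ S → h (S [ i ]≔ s))
      collect inside  ≡.refl = trans (+-cong (*-congˡ kept) (*-congˡ dropped))
        (solve 2 (λ x y → x :+ y :* con (+ 0) := x) refl _ _)
      collect outside ≡.refl = trans (+-cong (*-congˡ dropped) (*-congˡ kept))
        (solve 2 (λ x y → y :* con (+ 0) :+ x := x) refl _ _)

    -- By independence this is the mean of f conditioned on i having side s.
    conditionalMean : (Subset n → Carrier) → Fin n → Side → Carrier
    conditionalMean f i s = E distribution (λ S → f (S [ i ]≔ s))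

    -- The defining relation of a conditional expectation, multiplied out. It is what gives the term
    -- 𝟙 * (f - c) mean zero.
    conditionalMean-* : ∀ f i s → conditionalMean f i s * E distribution (𝟙 ∘ hasSide i s)
                                  ≈ E distribution (λ S → 𝟙 (hasSide i s S) * f S)
    conditionalMean-* f i s = begin-equality
      conditionalMean f i s * E distribution (𝟙 ∘ hasSide i s)
        ≈⟨ *-congˡ (E-cong distribution (λ S → *-identityʳ (𝟙 (hasSide i s S)))) ⟨
      conditionalMean f i s * E distribution (λ S → 𝟙 (hasSide i s S) * 1#)
        ≈⟨ *-congˡ (trans (E-hasSide i s (λ _ → 1#)) (*-congˡ (E-const distribution-isProbability 1#))) ⟩
      conditionalMean f i s * (weight (lookup inclusion i) s * 1#)
        ≈⟨ solve 2 (λ c w → c :* (w :* con (+ 1)) := w :* c) refl _ _ ⟩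
      weight (lookup inclusion i) s * conditionalMean f i s
        ≈⟨ E-hasSide i s f ⟨
      E distribution (λ S → 𝟙 (hasSide i s S) * f S) ∎

-- Marginals, the optimum and the loss through curvature

module SetFunctions {a ℓ₁ ℓ₂ : Level} (K : ArchimedeanOrderedField a ℓ₁ ℓ₂) where
  open ArchimedeanOrderedField K hiding (zero)
  open Optimization K
  open IntegerSolver K
  open OrderedFieldProperties K
  open Expectation K
  open Extrema totalOrder using (argmax-sel; xs≤max; ⊥≤max)
  open import Relation.Binary.Reasoning.PartialOrder ≤-poset

  ∑∈ : Subset n → (Fin n → Carrier) → Carrier
  ∑∈ {n} S g = ∑ (filter (_∈? S) (allFin n)) g

  ∑-allFin-suc : ∀ (g : Fin (suc n) → Carrier) → ∑ (allFin (suc n)) g ≈ g zero + ∑ (allFin n) (g ∘ suc)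
  ∑-allFin-suc {n} g = +-congˡ (trans
    (reflexive (≡.cong (λ is → ∑ is g) (≡.sym (List.map-tabulate id suc))))
    (∑-map (allFin n) suc g))

  ∑∈-∷ : ∀ s (S : Subset n) g → ∑∈ (s ∷ S) g ≈ (if s then g zero else 0#) + ∑∈ S (g ∘ suc)
  ∑∈-∷ {n} s S g = begin-equality
    ∑∈ (s ∷ S) g
      ≈⟨ ∑-filter (_∈? (s ∷ S)) (allFin (suc n)) g ⟩
    ∑ (allFin (suc n)) (λ i → if does (i ∈? (s ∷ S)) then g i else 0#)
      ≈⟨ ∑-allFin-suc (λ i → if does (i ∈? (s ∷ S)) then g i else 0#) ⟩
    (if does (zero ∈? (s ∷ S)) then g zero else 0#) + ∑ (allFin n) (λ i → if does (i ∈? S) then g (suc i) else 0#)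
      ≈⟨ +-cong (head s) (sym (∑-filter (_∈? S) (allFin n) (g ∘ suc))) ⟩
    (if s then g zero else 0#) + ∑∈ S (g ∘ suc) ∎
    where
    head : ∀ s → (if does (zero ∈? (s ∷ S)) then g zero else 0#) ≈ (if s then g zero else 0#)
    head inside  = refl
    head outside = refl

  ∑∈-const : ∀ (S : Subset n) c → ∑∈ S (λ _ → c) ≈ fromℕ ∣ S ∣ * c
  ∑∈-const []            c = sym (zeroˡ c)
  ∑∈-const (inside  ∷ S) c = begin-equality
    ∑∈ (inside ∷ S) (λ _ → c)  ≈⟨ ∑∈-∷ inside S (λ _ → c) ⟩
    c + ∑∈ S (λ _ → c)         ≈⟨ +-congˡ (∑∈-const S c) ⟩
    c + fromℕ ∣ S ∣ * c        ≈⟨ solve 2 (λ c k → c :+ k :* c := (con (+ 1) :+ k) :* c) refl c (fromℕ ∣ S ∣) ⟩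
    fromℕ (suc ∣ S ∣) * c      ∎
  ∑∈-const (outside ∷ S) c = trans (∑∈-∷ outside S (λ _ → c)) (trans (+-identityˡ _) (∑∈-const S c))

  -- In this form of the marginal no condition on the membership of i is needed.
  gain : SetFunction n → Subset n → Fin n → Carrier
  gain f S i = f (S [ i ]≔ inside) - f (S [ i ]≔ outside)

  -- `f S - f ∅` telescopes along the chain that adds the elements of `S` in increasing order, and
  -- each link is a gain. The induction fixes the first coordinate and continues with `f` restricted
  -- to that half of the cube.
  ∑∈≤ : ∀ (f : SetFunction n) g → (∀ S i → g i ≤ gain f S i) → ∀ S → ∑∈ S g ≤ f S - f ∅
  ∑∈≤ f g g≤ []            = ≤-reflexive (sym (-‿inverseʳ (f [])))
  ∑∈≤ f g g≤ (outside ∷ S) = begin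
    ∑∈ (outside ∷ S) g                   ≈⟨ trans (∑∈-∷ outside S g) (+-identityˡ _) ⟩
    ∑∈ S (g ∘ suc)                       ≤⟨ ∑∈≤ (f ∘ (outside ∷_)) (g ∘ suc) (λ S i → g≤ (outside ∷ S) (suc i)) S ⟩
    f (outside ∷ S) - f (outside ∷ ∅)    ∎
  ∑∈≤ f g g≤ (inside ∷ S)  = begin
    ∑∈ (inside ∷ S) g                    ≈⟨ ∑∈-∷ inside S g ⟩
    g zero + ∑∈ S (g ∘ suc)
      ≤⟨ +-mono-≤ (g≤ (inside ∷ ∅) zero)
                  (∑∈≤ (f ∘ (inside ∷_)) (g ∘ suc) (λ S i → g≤ (inside ∷ S) (suc i)) S) ⟩
    (f (inside ∷ ∅) - f (outside ∷ ∅)) + (f (inside ∷ S) - f (inside ∷ ∅))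
      ≈⟨ solve 3 (λ x y z → (x :- y) :+ (z :- x) := z :- y) refl _ _ _ ⟩
    f (inside ∷ S) - f (outside ∷ ∅)     ∎

  ≤∑∈ : ∀ (f : SetFunction n) g → (∀ S i → gain f S i ≤ g i) → ∀ S → f S - f ∅ ≤ ∑∈ S g
  ≤∑∈ f g ≤g []            = ≤-reflexive (-‿inverseʳ (f []))
  ≤∑∈ f g ≤g (outside ∷ S) = begin
    f (outside ∷ S) - f (outside ∷ ∅)    ≤⟨ ≤∑∈ (f ∘ (outside ∷_)) (g ∘ suc) (λ S i → ≤g (outside ∷ S) (suc i)) S ⟩
    ∑∈ S (g ∘ suc)                       ≈⟨ trans (∑∈-∷ outside S g) (+-identityˡ _) ⟨
    ∑∈ (outside ∷ S) g                   ∎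
  ≤∑∈ f g ≤g (inside ∷ S)  = begin
    f (inside ∷ S) - f (outside ∷ ∅)
      ≈⟨ solve 3 (λ x y z → z :- y := (x :- y) :+ (z :- x)) refl _ _ _ ⟩
    (f (inside ∷ ∅) - f (outside ∷ ∅)) + (f (inside ∷ S) - f (inside ∷ ∅))
      ≤⟨ +-mono-≤ (≤g (inside ∷ ∅) zero)
                  (≤∑∈ (f ∘ (inside ∷_)) (g ∘ suc) (λ S i → ≤g (inside ∷ S) (suc i)) S) ⟩
    g zero + ∑∈ S (g ∘ suc)              ≈⟨ ∑∈-∷ inside S g ⟨
    ∑∈ (inside ∷ S) g                    ∎

  -- The optimum ranges over sizes at most `k`, while the arg max of the algorithm compares only
  -- sets of size exactly `k`. Monotonicity closes the gap.
  extend-to-size : ∀ (f : SetFunction n) → (∀ S i → 0# ≤ gain f S i) →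
    ∀ {k} T → ∣ T ∣ ℕ.≤ k → k ℕ.≤ n → ∃ λ T′ → ∣ T′ ∣ ≡ k × f T ≤ f T′
  extend-to-size f mono []            _       ℕ.z≤n = [] , ≡.refl , ≤-refl
  extend-to-size f mono (inside ∷ T)  (ℕ.s≤s ∣T∣≤k) (ℕ.s≤s k≤n) =
    let T′ , ∣T′∣≡k , le = extend-to-size (f ∘ (inside ∷_)) (λ S i → mono (inside ∷ S) (suc i)) T ∣T∣≤k k≤n
    in inside ∷ T′ , ≡.cong suc ∣T′∣≡k , le
  extend-to-size {suc n} f mono {k} (outside ∷ T) ∣T∣≤k k≤1+n with k ℕ.≤? n
  ... | yes k≤n =
    let T′ , ∣T′∣≡k , le = extend-to-size (f ∘ (outside ∷_)) (λ S i → mono (outside ∷ S) (suc i)) T ∣T∣≤k k≤n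
    in outside ∷ T′ , ∣T′∣≡k , le
  -- Here `k` is `suc n`, which forces the whole ground set: the tail is filled completely before
  -- element zero is added.
  ... | no  k≰n =
    let T′ , ∣T′∣≡n , le = extend-to-size (f ∘ (outside ∷_)) (λ S i → mono (outside ∷ S) (suc i)) T (∣p∣≤n T) ℕ.≤-refl
    in inside ∷ T′ , ≡.trans (≡.cong suc ∣T′∣≡n) (ℕ.≤-antisym (ℕ.≰⇒> k≰n) k≤1+n)
       , ≤-trans le (0≤y-x⇒x≤y (mono (inside ∷ T′) zero))

  module _ (f : SetFunction n) (k : ℕ) where
    private
      feasible : List (Subset n)
      feasible = filter (λ T → ∣ T ∣ ℕ.≤? k) (subsets n)

    f≤optimum : ∀ {T} → ∣ T ∣ ℕ.≤ k → f T ≤ optimum f k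
    f≤optimum {T} ∣T∣≤k = All.lookup (xs≤max (f ∅) (map f feasible))
      (∈-map⁺ f (∈-filter⁺ (λ T → ∣ T ∣ ℕ.≤? k) (∈-subsets T) ∣T∣≤k))

    f∅≤optimum : f ∅ ≤ optimum f k
    f∅≤optimum = ⊥≤max (f ∅) (map f feasible)

    optimum-attained : ∃ λ T → ∣ T ∣ ℕ.≤ k × optimum f k ≡ f T
    optimum-attained with argmax-sel id (f ∅) (map f feasible)
    -- The maximum is the default value `f ∅`, and ∅ is feasible for every `k`.
    ... | inj₁ eq = ∅ , ≡.subst (ℕ._≤ k) (≡.sym (∣⊥∣≡0 n)) ℕ.z≤n , eq
    ... | inj₂ m∈ = let T , T∈ , eq = ∈-map⁻ f m∈
                    in T , proj₂ (∈-filter⁻ (λ T → ∣ T ∣ ℕ.≤? k) {xs = subsets n} T∈) , eq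

  marginal-∖ : ∀ (f : SetFunction n) S i → marginal f (S ∖ i) i ≡ gain f S i
  marginal-∖ f S i = ≡.cong₂ (λ X Y → f X - f Y) (∖-∪-⁅⁆ S i) (∖-update S i)

  monotone⇒gain : ∀ {f : SetFunction n} → Monotone f → ∀ S i → 0# ≤ gain f S i
  monotone⇒gain {f = f} mono S i = ≤-respʳ-≈ (reflexive (marginal-∖ f S i)) (mono (S ∖ i) i)

  -- The marginal at `S ∖ i` is compared with the one at ∅. Dropping the subtracted `f ∅` is where
  -- nonnegativity enters.
  submodular⇒gain : ∀ {f : SetFunction n} → Nonnegative f → Submodular f → ∀ S i → gain f S i ≤ f ⁅ i ⁆
  submodular⇒gain {f = f} nonneg sub S i = begin
    gain f S i             ≡⟨ marginal-∖ f S i ⟨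
    marginal f (S ∖ i) i   ≤⟨ sub ∅ (S ∖ i) i ⊥⊆ ⟩
    f (∅ ∪ ⁅ i ⁆) - f ∅    ≡⟨ ≡.cong (λ X → f X - f ∅) (∪-identityˡ ⁅ i ⁆) ⟩
    f ⁅ i ⁆ - f ∅          ≤⟨ ≤-by (nonneg ∅) (solve 2 (λ x y → y := x :- (x :- y)) refl _ _) ⟩
    f ⁅ i ⁆                ∎

  -- The minimum constrains only elements with nonzero singleton value. For the others the left side
  -- vanishes and monotonicity suffices.
  minimalRatio⇒gain : ∀ {f : SetFunction n} {μ} → Nonnegative f → Monotone f → IsMinimalRatio f μ →
                      ∀ S i → μ * f ⁅ i ⁆ ≤ gain f S i
  minimalRatio⇒gain {f = f} {μ} nonneg mono (min , _) S i with f ⁅ i ⁆ ≟ 0#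
  ... | yes f≈0 = begin
    μ * f ⁅ i ⁆  ≈⟨ trans (*-congˡ f≈0) (zeroʳ μ) ⟩
    0#           ≤⟨ monotone⇒gain mono S i ⟩
    gain f S i   ∎
  ... | no  f≉0 = begin
    μ * f ⁅ i ⁆                                ≈⟨ *-comm μ _ ⟩
    f ⁅ i ⁆ * μ                                ≤⟨ *-monoʳ-≤ (nonneg ⁅ i ⁆) (min i S f≉0) ⟩
    f ⁅ i ⁆ * (marginal f (S ∖ i) i / f ⁅ i ⁆) ≈⟨ x*[y/x]≈y _ f≉0 ⟩
    marginal f (S ∖ i) i                       ≡⟨ marginal-∖ f S i ⟩
    gain f S i                                 ∎

  module _ {f : SetFunction n} {μ : Carrier} (nonneg : Nonnegative f) (min : IsMinimalRatio f μ) where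
    private
      e : Fin n
      e = proj₁ (proj₂ min)
      S : Subset n
      S = proj₁ (proj₂ (proj₂ min))

      -- At a pair attaining the minimum the product is an actual gain, hence lies between zero and
      -- `f ⁅ e ⁆`. Cancelling the positive `f ⁅ e ⁆` then places `μ` between 0 and 1.
      f⁅e⁆μ : f ⁅ e ⁆ * μ ≈ gain f S e
      f⁅e⁆μ = begin-equality
        f ⁅ e ⁆ * μ                                 ≈⟨ *-congˡ (proj₂ (proj₂ (proj₂ (proj₂ min)))) ⟩
        f ⁅ e ⁆ * (marginal f (S ∖ e) e / f ⁅ e ⁆)  ≈⟨ x*[y/x]≈y _ (proj₁ (proj₂ (proj₂ (proj₂ min)))) ⟩
        marginal f (S ∖ e) e                        ≡⟨ marginal-∖ f S e ⟩
        gain f S e                                  ∎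

    positive-singleton : ∃ λ i → 0# < f ⁅ i ⁆
    positive-singleton = e , nonneg ⁅ e ⁆ , λ 0≈f → proj₁ (proj₂ (proj₂ (proj₂ min))) (sym 0≈f)

    minimalRatio-nonneg : Monotone f → 0# ≤ μ
    minimalRatio-nonneg mono = *-cancelˡ-≤ (proj₂ positive-singleton) (begin
      f ⁅ e ⁆ * 0#  ≈⟨ zeroʳ _ ⟩
      0#            ≤⟨ monotone⇒gain mono S e ⟩
      gain f S e    ≈⟨ f⁅e⁆μ ⟨
      f ⁅ e ⁆ * μ   ∎)

    minimalRatio≤1 : Submodular f → μ ≤ 1#
    minimalRatio≤1 sub = *-cancelˡ-≤ (proj₂ positive-singleton) (begin
      f ⁅ e ⁆ * μ   ≈⟨ f⁅e⁆μ ⟩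
      gain f S e    ≤⟨ submodular⇒gain nonneg sub S e ⟩
      f ⁅ e ⁆       ≈⟨ *-identityʳ _ ⟨
      f ⁅ e ⁆ * 1#  ∎)

  module _ {f : SetFunction n} {μ θ : Carrier} {v v̂ : Fin n → Carrier}
           (0≤μ : 0# ≤ μ) (μ≤1 : μ ≤ 1#) (0≤f∅ : 0# ≤ f ∅) (0≤θ : 0# ≤ θ)
           (gain≤ : ∀ S i → gain f S i ≤ f ⁅ i ⁆) (gain≥ : ∀ S i → μ * f ⁅ i ⁆ ≤ gain f S i)
           (v≤ : ∀ i → v i ≤ f ⁅ i ⁆) (v≥ : ∀ i → μ * f ⁅ i ⁆ ≤ v i)
           (close : ∀ i → ∣ v̂ i - v i ∣≤ θ) where

    -- One factor `μ` is lost on `T`, in passing from its value to the contributions of its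
    -- elements, and one on `S`, in passing back from singleton values to `f S`. The error `θ`
    -- enters `k` times for each of the two sets.
    maximiser-approximates : ∀ {k S T} → ∣ S ∣ ≡ k → ∣ T ∣ ≡ k → ∑∈ T v̂ ≤ ∑∈ S v̂ →
      μ * μ * f T - (fromℕ k * θ + fromℕ k * θ) ≤ f S
    maximiser-approximates {k} {S} {T} ∣S∣≡k ∣T∣≡k v̂T≤v̂S = begin
      μ * μ * f T - (t + t)
        -- The slack is (1 - μ²) f(∅) + (1 - μ) (t + t), nonnegative because 0 ≤ μ ≤ 1 and f(∅) ≥ 0.
        ≤⟨ ≤-by (+-nonneg (*-nonneg (x≤y⇒0≤y-x μ²≤1) 0≤f∅) (*-nonneg (x≤y⇒0≤y-x μ≤1) (+-nonneg 0≤t 0≤t)))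
             (solve 4 (λ μ x y t → (con (+ 1) :- μ :* μ) :* y :+ (con (+ 1) :- μ) :* (t :+ t)
                 := (μ :* (μ :* (x :- y) :- (t :+ t)) :+ y) :- (μ :* μ :* x :- (t :+ t))) refl μ (f T) (f ∅) t) ⟩
      μ * (μ * (f T - f ∅) - (t + t)) + f ∅
        ≤⟨ +-monoˡ-≤ (f ∅) (*-monoʳ-≤ 0≤μ chain) ⟩
      μ * ∑∈ S (λ i → f ⁅ i ⁆) + f ∅
        ≈⟨ +-congʳ (∑-*ˡ (members S) μ _) ⟨
      ∑∈ S (λ i → μ * f ⁅ i ⁆) + f ∅
        ≤⟨ +-monoˡ-≤ (f ∅) (∑∈≤ f (λ i → μ * f ⁅ i ⁆) gain≥ S) ⟩
      (f S - f ∅) + f ∅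
        ≈⟨ solve 2 (λ x y → x :- y :+ y := x) refl (f S) (f ∅) ⟩
      f S ∎
      where
      members : Subset n → List (Fin n)
      members S = filter (_∈? S) (allFin n)
      t : Carrier
      t = fromℕ k * θ
      0≤t : 0# ≤ t
      0≤t = *-nonneg (fromℕ-nonneg k) 0≤θ
      μ²≤1 : μ * μ ≤ 1#
      μ²≤1 = ≤-respʳ-≈ (*-identityˡ 1#) (*-mono-≤ 0≤μ 0≤1 μ≤1 μ≤1)
      error : ∀ S → ∣ S ∣ ≡ k → ∑∈ S (λ _ → θ) ≈ t
      error S eq = trans (∑∈-const S θ) (*-congʳ (reflexive (≡.cong fromℕ eq)))
      chain : μ * (f T - f ∅) - (t + t) ≤ ∑∈ S (λ i → f ⁅ i ⁆)
      chain = begin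
        μ * (f T - f ∅) - (t + t)
          ≤⟨ +-monoˡ-≤ _ (*-monoʳ-≤ 0≤μ (≤∑∈ f (λ i → f ⁅ i ⁆) gain≤ T)) ⟩
        μ * ∑∈ T (λ i → f ⁅ i ⁆) - (t + t)
          ≈⟨ +-congʳ (∑-*ˡ (members T) μ _) ⟨
        ∑∈ T (λ i → μ * f ⁅ i ⁆) - (t + t)
          ≤⟨ +-monoˡ-≤ _ (∑-mono (members T) λ i → ≤-trans (v≥ i)
               (≤-by (x≤y⇒0≤y-x (proj₁ (close i))) (solve 3 (λ x y t → (x :- y) :- (:- t) := (x :+ t) :- y) refl (v̂ i) (v i) θ))) ⟩
        ∑∈ T (λ i → v̂ i + θ) - (t + t)
          ≈⟨ +-congʳ (trans (∑-+ (members T) v̂ _) (+-congˡ (error T ∣T∣≡k))) ⟩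
        (∑∈ T v̂ + t) - (t + t)
          ≤⟨ +-monoˡ-≤ _ (+-monoˡ-≤ t v̂T≤v̂S) ⟩
        (∑∈ S v̂ + t) - (t + t)
          ≤⟨ +-monoˡ-≤ _ (+-monoˡ-≤ t (∑-mono (members S) λ i →
               ≤-trans (≤-by (x≤y⇒0≤y-x (proj₂ (close i))) (solve 3 (λ x y t → t :- (x :- y) := (y :+ t) :- x) refl (v̂ i) (v i) θ))
                       (+-monoˡ-≤ θ (v≤ i)))) ⟩
        (∑∈ S (λ i → f ⁅ i ⁆ + θ) + t) - (t + t)
          ≈⟨ +-congʳ (+-congʳ (trans (∑-+ (members S) _ _) (+-congˡ (error S ∣S∣≡k)))) ⟩
        (∑∈ S (λ i → f ⁅ i ⁆) + t + t) - (t + t)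
          ≈⟨ solve 2 (λ x t → (x :+ t :+ t) :- (t :+ t) := x) refl _ t ⟩
        ∑∈ S (λ i → f ⁅ i ⁆) ∎

-- Concentration of an average over a random sub-sample

module Concentration {a ℓ₁ ℓ₂ : Level} (K : ArchimedeanOrderedField a ℓ₁ ℓ₂) where
  open ArchimedeanOrderedField K hiding (zero)
  open Optimization K
  open IntegerSolver K
  open OrderedFieldProperties K
  open Expectation K
  open import Relation.Binary.Reasoning.PartialOrder ≤-poset

  -- Here `C` is the size of the sub-sample, `F` the sum of its values and `a` the conditional mean.
  -- The bound on `C - m * p` forces m ≤ 2 L C, so `C` is positive, the arbitrary value of `0# ⁻¹`
  -- never arises, and the bound on `F - a * C` can be divided by 2 L C. The factor `w` scales the
  -- hypotheses so that the quotient is accurate to O / R.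
  ratio-close : ∀ {R L O m p C F a} → 1# ≤ R → 0# < L → 0# ≤ O → 0# < m → 1# ≤ L * p →
    let w = (1# + 1#) * (R * L) in
    ∣ w * (F - a * C) ∣≤ O * m → ∣ w * (C - m * p) ∣≤ m → ∣ R * (F / C - a) ∣≤ O
  ratio-close {R} {L} {O} {m} {p} {C} {F} {a} 1≤R 0<L 0≤O 0<m 1≤Lp (lowerF , upperF) (lowerC , _) =
      *-cancelˡ-≤ 0<2LC (begin
        2L * C * - O         ≈⟨ solve 3 (λ l c o → l :* c :* (:- o) := :- (o :* (l :* c))) refl 2L C O ⟩
        - (O * (2L * C))     ≤⟨ neg-mono-≤ (*-monoʳ-≤ 0≤O m≤2LC) ⟩
        - (O * m)            ≤⟨ lowerF ⟩
        w * (F - a * C)      ≈⟨ scaled ⟩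
        2L * C * (R * (F / C - a)) ∎)
    , *-cancelˡ-≤ 0<2LC (begin
        2L * C * (R * (F / C - a)) ≈⟨ scaled ⟨
        w * (F - a * C)      ≤⟨ upperF ⟩
        O * m                ≤⟨ *-monoʳ-≤ 0≤O m≤2LC ⟩
        O * (2L * C)         ≈⟨ *-comm O _ ⟩
        2L * C * O           ∎)
    where
    w 2L : Carrier
    w  = (1# + 1#) * (R * L)
    2L = (1# + 1#) * L
    0<R : 0# < R
    0<R = <-≤-trans 0<1 1≤R
    m≤2LC : m ≤ 2L * C
    m≤2LC = *-cancelˡ-≤ 0<R (begin
      R * m
        -- L p ≥ 1 gives w m p ≥ 2 R m, and R ≥ 1 pays for the subtracted m.
        ≤⟨ ≤-by (+-nonneg (*-nonneg (*-nonneg (+-nonneg 0≤1 0≤1) (*-nonneg (proj₁ 0<R) (proj₁ 0<m))) (x≤y⇒0≤y-x 1≤Lp))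
                          (*-nonneg (x≤y⇒0≤y-x 1≤R) (proj₁ 0<m)))
             (solve 4 (λ R L m p → (con (+ 1) :+ con (+ 1)) :* (R :* m) :* (L :* p :- con (+ 1)) :+ (R :- con (+ 1)) :* m
                 := ((con (+ 1) :+ con (+ 1)) :* (R :* L) :* (m :* p) :- m) :- R :* m) refl R L m p) ⟩
      w * (m * p) - m
        ≤⟨ ≤-by (x≤y⇒0≤y-x lowerC) (solve 4 (λ w c mp m → w :* (c :- mp) :- (:- m) := w :* c :- (w :* mp :- m)) refl w C (m * p) m) ⟩
      w * C
        ≈⟨ solve 3 (λ R L C → (con (+ 1) :+ con (+ 1)) :* (R :* L) :* C := R :* ((con (+ 1) :+ con (+ 1)) :* L :* C)) refl R L C ⟩
      R * (2L * C) ∎)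
    0<2LC : 0# < 2L * C
    0<2LC = <-≤-trans 0<m m≤2LC
    C≉0 : ¬ C ≈ 0#
    C≉0 C≈0 = 0<⇒≉0 0<2LC (trans (*-congˡ C≈0) (zeroʳ 2L))
    scaled : w * (F - a * C) ≈ 2L * C * (R * (F / C - a))
    scaled = begin-equality
      w * (F - a * C)
        ≈⟨ *-congˡ (+-congʳ (x*[y/x]≈y F C≉0)) ⟨
      w * (C * (F / C) - a * C)
        ≈⟨ solve 5 (λ R L C x a → (con (+ 1) :+ con (+ 1)) :* (R :* L) :* (C :* x :- a :* C)
              := (con (+ 1) :+ con (+ 1)) :* L :* C :* (R :* (x :- a))) refl R L C (F / C) a ⟩
      2L * C * (R * (F / C - a)) ∎

  module ConditionalAverage {b : Level} {A : Set b} {D : Distribution A} (D-prob : IsProbability D)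
    (r : A → Bool) (f : A → Carrier) {c B : Carrier}
    (0≤f : ∀ x → 0# ≤ f x) (f≤B : ∀ x → f x ≤ B) (0≤c : 0# ≤ c) (c≤B : c ≤ B)
    (c-conditional : c * E D (𝟙 ∘ r) ≈ E D (λ x → 𝟙 (r x) * f x)) where
    open IsProbability

    private
      q : Carrier
      q = E D (𝟙 ∘ r)

      -- The centred summands: summing `Z` gives the values of the sub-sample less `c` times its
      -- size, summing `Y` gives the size less its mean.
      Z Y : A → Carrier
      Z x = 𝟙 (r x) * (f x - c)
      Y x = 𝟙 (r x) - q

      𝟙-nonneg : ∀ c → 0# ≤ 𝟙 c
      𝟙-nonneg true  = 0≤1
      𝟙-nonneg false = ≤-refl

      𝟙≤1 : ∀ c → 𝟙 c ≤ 1#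
      𝟙≤1 true  = ≤-refl
      𝟙≤1 false = 0≤1

      0≤q : 0# ≤ q
      0≤q = E-nonneg D-prob _ (λ x → 𝟙-nonneg (r x))

      q≤1 : q ≤ 1#
      q≤1 = ≤-respʳ-≈ (E-1 D-prob) (E-mono D-prob (λ x → 𝟙≤1 (r x)))

      Z≈ : ∀ x → Z x ≈ 𝟙 (r x) * f x - c * 𝟙 (r x)
      Z≈ x = solve 3 (λ i f c → i :* (f :- c) := i :* f :- c :* i) refl (𝟙 (r x)) (f x) c

      Z-centred : E D Z ≈ 0#
      Z-centred = begin-equality
        E D Z
          ≈⟨ E-cong D Z≈ ⟩
        E D (λ x → 𝟙 (r x) * f x - c * 𝟙 (r x))
          ≈⟨ trans (E-- D _ _) (+-cong (sym c-conditional) (-‿cong (E-*ˡ D c _))) ⟩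
        c * q - c * q
          ≈⟨ -‿inverseʳ (c * q) ⟩
        0# ∎

      Y-centred : E D Y ≈ 0#
      Y-centred = trans (E-- D _ _) (trans (+-congˡ (-‿cong (E-const D-prob q))) (-‿inverseʳ q))

      f-c-bounded : ∀ x → ∣ f x - c ∣≤ B
      f-c-bounded x =
        ≤-by (+-nonneg (0≤f x) (x≤y⇒0≤y-x c≤B)) (solve 3 (λ f c B → f :+ (B :- c) := (f :- c) :- (:- B)) refl (f x) c B) ,
        ≤-by (+-nonneg 0≤c (x≤y⇒0≤y-x (f≤B x))) (solve 3 (λ f c B → c :+ (B :- f) := B :- (f :- c)) refl (f x) c B)

      Z²≤ : ∀ x → Z x * Z x ≤ B * B
      Z²≤ x with r x
      ... | true  = ≤-respˡ-≈ (solve 1 (λ d → d :* d := (con (+ 1) :* d) :* (con (+ 1) :* d)) refl (f x - c))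
                      (∣x∣≤t⇒x²≤t² (f-c-bounded x))
      ... | false = ≤-respˡ-≈ (solve 1 (λ d → con (+ 0) := (con (+ 0) :* d) :* (con (+ 0) :* d)) refl (f x - c))
                      (square-nonneg B)

      Y²≤ : ∀ x → Y x * Y x ≤ 1#
      Y²≤ x = ≤-respʳ-≈ (*-identityˡ 1#) (∣x∣≤t⇒x²≤t²
        ( ≤-by (+-nonneg (𝟙-nonneg (r x)) (x≤y⇒0≤y-x q≤1)) (solve 2 (λ i q → i :+ (con (+ 1) :- q) := (i :- q) :- (:- con (+ 1))) refl (𝟙 (r x)) q)
        , ≤-by (+-nonneg (x≤y⇒0≤y-x (𝟙≤1 (r x))) 0≤q) (solve 2 (λ i q → (con (+ 1) :- i) :+ q := con (+ 1) :- (i :- q)) refl (𝟙 (r x)) q)))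

      ΣZ ΣY count total : ∀ {m} → Vec A m → Carrier
      ΣZ    xs = ∑ (Vec.toList xs) Z
      ΣY    xs = ∑ (Vec.toList xs) Y
      count xs = ∑ (Vec.toList xs) (𝟙 ∘ r)
      total xs = ∑ (Vec.toList xs) (λ x → 𝟙 (r x) * f x)

      ΣZ≈ : ∀ {m} (xs : Vec A m) → ΣZ xs ≈ total xs - c * count xs
      ΣZ≈ xs = trans (∑-cong (Vec.toList xs) Z≈)
        (trans (∑-- (Vec.toList xs) _ _) (+-congˡ (-‿cong (∑-*ˡ (Vec.toList xs) c _))))

      ΣY≈ : ∀ {m} (xs : Vec A m) → ΣY xs ≈ count xs - fromℕ m * q
      ΣY≈ xs = trans (∑-- (Vec.toList xs) _ _) (+-congˡ (-‿cong
        (trans (∑-const (Vec.toList xs) q) (*-congʳ (reflexive (≡.cong fromℕ (Vec.length-toList xs)))))))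

    -- The extra factor `O` in the second term brings both deviations to one scale, so that the
    -- single threshold (O m)² controls them together.
    deviation : ∀ {m} → Carrier → Carrier → Vec A m → Carrier
    deviation w O xs = w * ΣZ xs * (w * ΣZ xs) + w * O * ΣY xs * (w * O * ΣY xs)

    deviation-nonneg : ∀ {m} w O (xs : Vec A m) → 0# ≤ deviation w O xs
    deviation-nonneg w O xs = +-nonneg (square-nonneg _) (square-nonneg _)

    -- Independence leaves a bound linear in `m`, against a threshold quadratic in `m`. Markov's
    -- inequality therefore bounds the failure probability by a multiple of 1 / m.
    E-deviation : ∀ m w O → E (iid m D) (deviation w O) ≤ fromℕ m * (w * w * (B * B + O * O))
    E-deviation m w O = begin
      E (iid m D) (deviation w O)
        ≈⟨ E-cong (iid m D) (λ xs → solve 4 (λ w O z y → w :* z :* (w :* z) :+ w :* O :* y :* (w :* O :* y)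
             := w :* w :* (z :* z) :+ w :* w :* (O :* O) :* (y :* y)) refl w O (ΣZ xs) (ΣY xs)) ⟩
      E (iid m D) (λ xs → w * w * (ΣZ xs * ΣZ xs) + w * w * (O * O) * (ΣY xs * ΣY xs))
        ≈⟨ trans (E-+ (iid m D) _ _) (+-cong (E-*ˡ (iid m D) (w * w) _) (E-*ˡ (iid m D) (w * w * (O * O)) _)) ⟩
      w * w * E (iid m D) (λ xs → ΣZ xs * ΣZ xs) + w * w * (O * O) * E (iid m D) (λ xs → ΣY xs * ΣY xs)
        ≈⟨ +-cong (*-congˡ (E-iid-sum² D-prob Z-centred m)) (*-congˡ (E-iid-sum² D-prob Y-centred m)) ⟩
      w * w * (fromℕ m * E D (λ x → Z x * Z x)) + w * w * (O * O) * (fromℕ m * E D (λ x → Y x * Y x))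
        ≤⟨ +-mono-≤ (*-monoʳ-≤ (square-nonneg w) (*-monoʳ-≤ (fromℕ-nonneg m) (bounded Z²≤)))
                    (*-monoʳ-≤ (*-nonneg (square-nonneg w) (square-nonneg O)) (*-monoʳ-≤ (fromℕ-nonneg m) (bounded Y²≤))) ⟩
      w * w * (fromℕ m * (B * B)) + w * w * (O * O) * (fromℕ m * 1#)
        ≈⟨ solve 4 (λ w B O m → w :* w :* (m :* (B :* B)) :+ w :* w :* (O :* O) :* (m :* con (+ 1))
             := m :* (w :* w :* (B :* B :+ O :* O))) refl w B O (fromℕ m) ⟩
      fromℕ m * (w * w * (B * B + O * O)) ∎
      where
      bounded : ∀ {g : A → Carrier} {t} → (∀ x → g x ≤ t) → E D g ≤ t
      bounded g≤t = ≤-respʳ-≈ (E-const D-prob _) (E-mono D-prob g≤t)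

    average-close : ∀ {m R L O} (xs : Vec A m) →
      1# ≤ R → 0# < L → 0# < O → 0 ℕ.< m → 1# ≤ L * E D (𝟙 ∘ r) →
      deviation ((1# + 1#) * (R * L)) O xs ≤ O * fromℕ m * (O * fromℕ m) →
      ∣ R * (total xs / count xs - c) ∣≤ O
    average-close {m} {R} {L} {O} xs 1≤R 0<L 0<O 0<m 1≤Lq small =
      ratio-close 1≤R 0<L (proj₁ 0<O) (fromℕ-positive 0<m) 1≤Lq
        ( ≤-respʳ-≈ (*-congˡ (ΣZ≈ xs)) (proj₁ Z-small) , ≤-respˡ-≈ (*-congˡ (ΣZ≈ xs)) (proj₂ Z-small) )
        ( *-cancelˡ-≤ 0<O (≤-resp₂ (solve 2 (λ O m → :- (O :* m) := O :* (:- m)) refl O (fromℕ m)) rescale (proj₁ Y-small))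
        , *-cancelˡ-≤ 0<O (≤-respˡ-≈ rescale (proj₂ Y-small)) )
      where
      w : Carrier
      w = (1# + 1#) * (R * L)
      0≤Om : 0# ≤ O * fromℕ m
      0≤Om = *-nonneg (proj₁ 0<O) (fromℕ-nonneg m)
      Z-small : ∣ w * ΣZ xs ∣≤ O * fromℕ m
      Z-small = x²≤t²⇒∣x∣≤t 0≤Om (≤-trans
        (≤-by (square-nonneg (w * O * ΣY xs)) (solve 2 (λ x y → y := (x :+ y) :- x) refl _ _)) small)
      Y-small : ∣ w * O * ΣY xs ∣≤ O * fromℕ m
      Y-small = x²≤t²⇒∣x∣≤t 0≤Om (≤-trans
        (≤-by (square-nonneg (w * ΣZ xs)) (solve 2 (λ x y → x := (x :+ y) :- y) refl _ _)) small)
      ≤-resp₂ : ∀ {x x′ y y′} → x ≈ x′ → y ≈ y′ → x ≤ y → x′ ≤ y′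
      ≤-resp₂ x≈x′ y≈y′ x≤y = ≤-respˡ-≈ x≈x′ (≤-respʳ-≈ y≈y′ x≤y)
      rescale : w * O * ΣY xs ≈ O * (w * (count xs - fromℕ m * q))
      rescale = trans (*-congˡ (ΣY≈ xs)) (solve 3 (λ w O y → w :* O :* y := O :* (w :* y)) refl w O _)

  -- The filtered list has random length. Summing indicators over the whole sample puts numerator
  -- and denominator in the form that the second-moment bounds treat.
  average-filter : ∀ {n m} (f : SetFunction n) {P : Subset n → Set p} (P? : ∀ S → Dec (P S)) (Ss : Vec (Subset n) m) →
    average (filter (λ (S , _) → P? S) (observe f Ss))
      ≈ ∑ (Vec.toList Ss) (λ S → 𝟙 (does (P? S)) * f S) / ∑ (Vec.toList Ss) (𝟙 ∘ does ∘ P?)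
  average-filter {n = n} f P? Ss = *-cong
    (trans (over proj₂) (∑-cong (Vec.toList Ss) λ S → if-* (does (P? S)) (f S)))
    (⁻¹-cong (trans (trans (sym (*-identityʳ _)) (sym (∑-const (filter (λ (S , _) → P? S) (observe f Ss)) 1#))) (over (λ _ → 1#))))
    where
    over : ∀ (g : Subset n × Carrier → Carrier) →
      ∑ (filter (λ (S , _) → P? S) (observe f Ss)) g
        ≈ ∑ (Vec.toList Ss) (λ S → if does (P? S) then g (S , f S) else 0#)
    over g = begin-equality
      ∑ (filter (λ (S , _) → P? S) (observe f Ss)) g
        ≈⟨ ∑-filter (λ (S , _) → P? S) (observe f Ss) g ⟩
      ∑ (observe f Ss) g′
        ≡⟨ ≡.cong (λ xs → ∑ xs g′) (Vec.toList-map (λ S → S , f S) Ss) ⟩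
      ∑ (map (λ S → S , f S) (Vec.toList Ss)) g′
        ≈⟨ ∑-map (Vec.toList Ss) (λ S → S , f S) g′ ⟩
      ∑ (Vec.toList Ss) (λ S → if does (P? S) then g (S , f S) else 0#) ∎
      where
      g′ : Subset n × Carrier → Carrier
      g′ (S , y) = if does (P? S) then g (S , y) else 0#
    if-* : ∀ c y → (if c then y else 0#) ≈ 𝟙 c * y
    if-* true  y = sym (*-identityˡ y)
    if-* false y = sym (zeroˡ y)

-- Polynomial bounds on the sample size

infixl 6 _⊞_
infixl 7 _⊠_

_⊞_ : Polynomial → Polynomial → Polynomial
[]       ⊞ bs       = bs
as       ⊞ []       = as
(a ∷ as) ⊞ (b ∷ bs) = a ℕ.+ b ∷ as ⊞ bs

_⊠_ : Polynomial → Polynomial → Polynomial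
[]       ⊠ bs = []
(a ∷ as) ⊠ bs = map (a ℕ.*_) bs ⊞ (0 ∷ as ⊠ bs)

eval-⊞ : ∀ as bs x → eval (as ⊞ bs) x ≡ eval as x ℕ.+ eval bs x
eval-⊞ []       bs       x = ≡.refl
eval-⊞ (a ∷ as) []       x = ≡.sym (ℕ.+-identityʳ _)
eval-⊞ (a ∷ as) (b ∷ bs) x = begin
  a ℕ.+ b ℕ.+ x ℕ.* eval (as ⊞ bs) x                  ≡⟨ ≡.cong (λ y → a ℕ.+ b ℕ.+ x ℕ.* y) (eval-⊞ as bs x) ⟩
  a ℕ.+ b ℕ.+ x ℕ.* (eval as x ℕ.+ eval bs x)         ≡⟨ rearrange a b x (eval as x) (eval bs x) ⟩
  (a ℕ.+ x ℕ.* eval as x) ℕ.+ (b ℕ.+ x ℕ.* eval bs x) ∎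
  where
  open ≡-Reasoning
  rearrange : ∀ a b x u v → a ℕ.+ b ℕ.+ x ℕ.* (u ℕ.+ v) ≡ (a ℕ.+ x ℕ.* u) ℕ.+ (b ℕ.+ x ℕ.* v)
  rearrange = solve-∀

eval-map-* : ∀ a bs x → eval (map (a ℕ.*_) bs) x ≡ a ℕ.* eval bs x
eval-map-* a []       x = ≡.sym (ℕ.*-zeroʳ a)
eval-map-* a (b ∷ bs) x = ≡.trans (≡.cong (λ y → a ℕ.* b ℕ.+ x ℕ.* y) (eval-map-* a bs x)) (rearrange a b x (eval bs x))
  where
  rearrange : ∀ a b x u → a ℕ.* b ℕ.+ x ℕ.* (a ℕ.* u) ≡ a ℕ.* (b ℕ.+ x ℕ.* u)
  rearrange = solve-∀

eval-⊠ : ∀ as bs x → eval (as ⊠ bs) x ≡ eval as x ℕ.* eval bs x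
eval-⊠ []       bs x = ≡.refl
eval-⊠ (a ∷ as) bs x = begin
  eval (map (a ℕ.*_) bs ⊞ (0 ∷ as ⊠ bs)) x                 ≡⟨ eval-⊞ (map (a ℕ.*_) bs) (0 ∷ as ⊠ bs) x ⟩
  eval (map (a ℕ.*_) bs) x ℕ.+ x ℕ.* eval (as ⊠ bs) x      ≡⟨ ≡.cong₂ (λ u v → u ℕ.+ x ℕ.* v) (eval-map-* a bs x) (eval-⊠ as bs x) ⟩
  a ℕ.* eval bs x ℕ.+ x ℕ.* (eval as x ℕ.* eval bs x)      ≡⟨ rearrange a x (eval as x) (eval bs x) ⟩
  (a ℕ.+ x ℕ.* eval as x) ℕ.* eval bs x                    ∎
  where
  open ≡-Reasoning
  rearrange : ∀ a x u v → a ℕ.* v ℕ.+ x ℕ.* (u ℕ.* v) ≡ (a ℕ.+ x ℕ.* u) ℕ.* v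
  rearrange = solve-∀

-- The reciprocal of the allowed error of each average, relative to the optimum.
precision : ℕ → ℕ
precision n = 4 ℕ.* (suc n ℕ.* suc n)

-- L⁻¹ is the lower bound on the marginals.  Times m optimum², this bounds the
-- expected total deviation.
variance : ℕ → ℕ → ℕ
variance L n = 2 ℕ.* n ℕ.* ((2 ℕ.* (precision n ℕ.* L)) ℕ.* (2 ℕ.* (precision n ℕ.* L)) ℕ.* (suc n ℕ.* suc n ℕ.+ 1))

-- Lets bounds be written as plain functions, while the closure lemmas assemble the coefficients
-- alongside.
IsPolynomial : (ℕ → ℕ) → Set
IsPolynomial g = ∃ λ p → ∀ x → eval p x ≡ g x

isPolynomial-eval : ∀ p → IsPolynomial (eval p)
isPolynomial-eval p = p , λ x → ≡.refl

isPolynomial-const : ∀ a → IsPolynomial (λ _ → a)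
isPolynomial-const a = a ∷ [] , λ x → ≡.trans (≡.cong (a ℕ.+_) (ℕ.*-zeroʳ x)) (ℕ.+-identityʳ a)

isPolynomial-id : IsPolynomial id
isPolynomial-id = 0 ∷ 1 ∷ [] , λ x →
  ≡.trans (≡.cong (λ y → x ℕ.* suc y) (ℕ.*-zeroʳ x)) (ℕ.*-identityʳ x)

isPolynomial-+ : ∀ {g h} → IsPolynomial g → IsPolynomial h → IsPolynomial (λ x → g x ℕ.+ h x)
isPolynomial-+ (p , p≡) (q , q≡) = p ⊞ q , λ x → ≡.trans (eval-⊞ p q x) (≡.cong₂ ℕ._+_ (p≡ x) (q≡ x))

isPolynomial-* : ∀ {g h} → IsPolynomial g → IsPolynomial h → IsPolynomial (λ x → g x ℕ.* h x)
isPolynomial-* (p , p≡) (q , q≡) = p ⊠ q , λ x → ≡.trans (eval-⊠ p q x) (≡.cong₂ ℕ._*_ (p≡ x) (q≡ x))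

-- The leading 1 makes the sample size exceed d times the variance strictly, which yields m > 0
-- whatever the variance.
isPolynomial-sampleSize : ∀ d P → IsPolynomial (λ n → 1 ℕ.+ d ℕ.* variance (eval P n) n)
isPolynomial-sampleSize d P = con 1 ⊕ (con d ⊛ (con 2 ⊛ isPolynomial-id ⊛ (w ⊛ w ⊛ (N ⊛ N ⊕ con 1))))
  where
  infixl 6 _⊕_
  infixl 7 _⊛_
  con = isPolynomial-const
  _⊕_ : ∀ {g h} → IsPolynomial g → IsPolynomial h → IsPolynomial (λ x → g x ℕ.+ h x)
  _⊕_ = isPolynomial-+
  _⊛_ : ∀ {g h} → IsPolynomial g → IsPolynomial h → IsPolynomial (λ x → g x ℕ.* h x)
  _⊛_ = isPolynomial-*
  N : IsPolynomial suc
  N = con 1 ⊕ isPolynomial-id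
  w : IsPolynomial (λ n → 2 ℕ.* (precision n ℕ.* eval P n))
  w = con 2 ⊛ (con 4 ⊛ (N ⊛ N) ⊛ isPolynomial-eval P)

-- Success probability of the algorithm

module Approximation {a ℓ₁ ℓ₂ : Level} (K : ArchimedeanOrderedField a ℓ₁ ℓ₂) where
  open ArchimedeanOrderedField K hiding (zero)
  open Optimization K
  open IntegerSolver K
  open OrderedFieldProperties K
  open Expectation K
  open ProductDistributionProperties K
  open SetFunctions K
  open Concentration K
  open ProductDistribution
  open import Relation.Binary.Reasoning.PartialOrder ≤-poset

  ε : ℕ → Carrier
  ε n = 1# / fromℕ (suc n)

  fromℕ-suc-positive : ∀ n → 0# < fromℕ (suc n)
  fromℕ-suc-positive n = fromℕ-positive {suc n} (ℕ.s≤s ℕ.z≤n)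

  ε-nonneg : ∀ n → 0# ≤ ε n
  ε-nonneg n = *-nonneg 0≤1 (⁻¹-nonneg (fromℕ-suc-positive n))

  ε-inverse : ∀ n → fromℕ (suc n) * ε n ≈ 1#
  ε-inverse n = x*[y/x]≈y 1# (0<⇒≉0 (fromℕ-suc-positive n))

  -- Supplies both the index from which `ε` stays below `η` and the integer that stands for 1 / δ in
  -- the sample size.
  archimedean-inverse : ∀ {η} → 0# < η → ∃ λ d → 1# ≤ fromℕ d * η
  archimedean-inverse {η} 0<η = let d , 1/η≤d = archimedean (1# / η) in d , (begin
    1#             ≈⟨ x*[y/x]≈y 1# (0<⇒≉0 0<η) ⟨
    η * (1# / η)   ≤⟨ *-monoʳ-≤ (proj₁ 0<η) 1/η≤d ⟩
    η * fromℕ d    ≈⟨ *-comm η _ ⟩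
    fromℕ d * η    ∎)

  ε-vanishing : Vanishing ε
  ε-vanishing η 0<η = let d , 1≤dη = archimedean-inverse 0<η in d , λ n d≤n →
      (begin
        - η                      ≤⟨ neg-mono-≤ (proj₁ 0<η) ⟩
        - 0#                     ≈⟨ solve 0 (:- con (+ 0) := con (+ 0)) refl ⟩
        0#                       ≤⟨ ε-nonneg n ⟩
        ε n                      ∎)
    , *-cancelˡ-≤ (fromℕ-suc-positive n) (begin
        fromℕ (suc n) * ε n      ≈⟨ ε-inverse n ⟩
        1#                       ≤⟨ 1≤dη ⟩
        fromℕ d * η              ≤⟨ *-monoˡ-≤ (proj₁ 0<η) (fromℕ-mono-≤ (ℕ.≤-trans d≤n (ℕ.n≤1+n n))) ⟩
        fromℕ (suc n) * η        ∎)

  ≤-∑-allFin : ∀ {g : Fin n → Carrier} → (∀ i → 0# ≤ g i) → ∀ i → g i ≤ ∑ (allFin n) g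
  ≤-∑-allFin {suc n} {g} 0≤g zero    = begin
    g zero                                ≈⟨ +-identityʳ _ ⟨
    g zero + 0#                           ≤⟨ +-monoʳ-≤ _ (∑-nonneg (allFin n) (λ i → 0≤g (suc i))) ⟩
    g zero + ∑ (allFin n) (g ∘ suc)       ≈⟨ ∑-allFin-suc g ⟨
    ∑ (allFin (suc n)) g                  ∎
  ≤-∑-allFin {suc n} {g} 0≤g (suc i) = begin
    g (suc i)                             ≤⟨ ≤-∑-allFin (λ i → 0≤g (suc i)) i ⟩
    ∑ (allFin n) (g ∘ suc)                ≈⟨ +-identityˡ _ ⟨
    0# + ∑ (allFin n) (g ∘ suc)           ≤⟨ +-monoˡ-≤ _ (0≤g zero) ⟩
    g zero + ∑ (allFin n) (g ∘ suc)       ≈⟨ ∑-allFin-suc g ⟨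
    ∑ (allFin (suc n)) g                  ∎

  1-δ≤ : ∀ {x δ t} → 0# < t → t * (1# - x) ≤ t * δ → 1# - δ ≤ x
  1-δ≤ {x} {δ} 0<t le = ≤-by (x≤y⇒0≤y-x (*-cancelˡ-≤ 0<t le))
    (solve 2 (λ x δ → δ :- (con (+ 1) :- x) := x :- (con (+ 1) :- δ)) refl x δ)

  module _ {n k m : ℕ} {f : SetFunction n} {μ : Carrier} {𝒟 : ProductDistribution n} {P : Polynomial}
           {maxMargCont : Algorithm n}
           (k≤n : k ℕ.≤ n) (nonneg : Nonnegative f) (mono : Monotone f) (sub : Submodular f)
           (min : IsMinimalRatio f μ) (bounded : BoundedMarginals P 𝒟)
           (isMax : IsMaxMargCont k maxMargCont) where
    private
      O : Carrier
      O = optimum f k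

      D : Distribution (Subset n)
      D = distribution 𝒟

      output : Vec (Subset n) m → Subset n
      output Ss = maxMargCont (observe f Ss)

      Good : Vec (Subset n) m → Set ℓ₂
      Good Ss = Approximates f k (μ * μ - ε n) (output Ss)

      0≤μ : 0# ≤ μ
      0≤μ = minimalRatio-nonneg nonneg min mono

      μ≤1 : μ ≤ 1#
      μ≤1 = minimalRatio≤1 nonneg min sub

      gain≥0 : ∀ S i → 0# ≤ gain f S i
      gain≥0 = monotone⇒gain mono

      gain≤ : ∀ S i → gain f S i ≤ f ⁅ i ⁆
      gain≤ = submodular⇒gain nonneg sub

      gain≥ : ∀ S i → μ * f ⁅ i ⁆ ≤ gain f S i
      gain≥ = minimalRatio⇒gain nonneg mono min

      μ²≤1 : μ * μ ≤ 1#
      μ²≤1 = ≤-respʳ-≈ (*-identityˡ 1#) (*-mono-≤ 0≤μ 0≤1 μ≤1 μ≤1)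

      module D = IsProbability (distribution-isProbability 𝒟)
      module Dᵐ = IsProbability (iid-isProbability m (distribution-isProbability 𝒟))

    -- Treated apart because the optimum is then `f ∅`, which may vanish and so cannot serve as the
    -- unit of error. The only feasible set is ∅, and the algorithm returns it.
    always-good-if-k≡0 : k ≡ 0 → ∀ Ss → Good Ss
    always-good-if-k≡0 ≡.refl Ss = ∣S∣≡0 , (begin
      (μ * μ - ε n) * O     ≤⟨ *-monoˡ-≤ (≤-trans (nonneg ∅) (f∅≤optimum f k)) μ²-ε≤1 ⟩
      1# * O                ≈⟨ *-identityˡ O ⟩
      O                     ≡⟨ O≡fT ⟩
      f T                   ≡⟨ ≡.cong f (≡.trans (∣S∣≡0⇒S≡∅ T (ℕ.n≤0⇒n≡0 ∣T∣≤0)) (≡.sym (∣S∣≡0⇒S≡∅ (output Ss) ∣S∣≡0))) ⟩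
      f (output Ss)         ∎)
      where
      ∣S∣≡0 = proj₁ (isMax (observe f Ss))
      T = proj₁ (optimum-attained f k)
      ∣T∣≤0 = proj₁ (proj₂ (optimum-attained f k))
      O≡fT = proj₂ (proj₂ (optimum-attained f k))
      μ²-ε≤1 : μ * μ - ε n ≤ 1#
      μ²-ε≤1 = ≤-by (+-nonneg (x≤y⇒0≤y-x μ²≤1) (ε-nonneg n))
        (solve 2 (λ x e → con (+ 1) :- x :+ e := con (+ 1) :- (x :- e)) refl (μ * μ) (ε n))

    module _ (0<k : 0 ℕ.< k) (0<m : 0 ℕ.< m) where
      private
        N L R w : Carrier
        N = fromℕ (suc n)
        L = fromℕ (eval P n)
        R = fromℕ (precision n)
        w = (1# + 1#) * (R * L)

        f⁅i⁆≤O : ∀ i → f ⁅ i ⁆ ≤ O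
        f⁅i⁆≤O i = f≤optimum f k (≡.subst (ℕ._≤ k) (≡.sym (∣⁅x⁆∣≡1 i)) 0<k)

        -- The curvature is attained at an element of nonzero value, so some singleton is positive,
        -- and singletons are feasible once k ≥ 1.
        0<O : 0# < O
        0<O = let i , 0<fi = positive-singleton nonneg min in <-≤-trans 0<fi (f⁅i⁆≤O i)

        f≤NO : ∀ S → f S ≤ N * O
        f≤NO S = begin
          f S                              ≈⟨ solve 2 (λ x y → x := y :+ (x :- y)) refl (f S) (f ∅) ⟩
          f ∅ + (f S - f ∅)                ≤⟨ +-mono-≤ (f∅≤optimum f k) (≤∑∈ f (λ _ → O) (λ S i → ≤-trans (gain≤ S i) (f⁅i⁆≤O i)) S) ⟩
          O + ∑∈ S (λ _ → O)               ≈⟨ +-congˡ (∑∈-const S O) ⟩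
          O + fromℕ ∣ S ∣ * O              ≤⟨ +-monoʳ-≤ O (*-monoˡ-≤ (proj₁ 0<O) (fromℕ-mono-≤ (∣p∣≤n S))) ⟩
          O + fromℕ n * O                  ≈⟨ solve 2 (λ O n → O :+ n :* O := (con (+ 1) :+ n) :* O) refl O (fromℕ n) ⟩
          N * O                            ∎

        c : Fin n → Side → Carrier
        c = conditionalMean 𝒟 f

        module Avg (i : Fin n) (s : Side) = ConditionalAverage (distribution-isProbability 𝒟)
          (hasSide i s) f nonneg f≤NO
          -- The conditional mean is a mean of values of `f`, so it lies in the same range from 0 to
          -- `N * O`.
          (D.E-nonneg _ (λ S → nonneg _))
          (≤-respʳ-≈ (D.E-const (N * O)) (D.E-mono (λ S → f≤NO _)))
          (conditionalMean-* 𝒟 f i s)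

        deviation : Fin n → Side → Vec (Subset n) m → Carrier
        deviation i s Ss = Avg.deviation i s w O Ss

        deviation-nonneg : ∀ i s Ss → 0# ≤ deviation i s Ss
        deviation-nonneg i s Ss = Avg.deviation-nonneg i s w O Ss

        U : Vec (Subset n) m → Carrier
        U Ss = ∑ (allFin n) (λ i → deviation i inside Ss + deviation i outside Ss)

        deviations-nonneg : ∀ Ss i → 0# ≤ deviation i inside Ss + deviation i outside Ss
        deviations-nonneg Ss i = +-nonneg (deviation-nonneg i inside Ss) (deviation-nonneg i outside Ss)

        deviation≤U : ∀ Ss i s → deviation i s Ss ≤ U Ss
        deviation≤U Ss i s = ≤-trans (side s) (≤-∑-allFin (deviations-nonneg Ss) i)
          where
          side : ∀ s → deviation i s Ss ≤ deviation i inside Ss + deviation i outside Ss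
          side inside  = ≤-by (deviation-nonneg i outside Ss)
            (solve 2 (λ x y → y := (x :+ y) :- x) refl (deviation i inside Ss) (deviation i outside Ss))
          side outside = ≤-by (deviation-nonneg i inside Ss)
            (solve 2 (λ x y → x := (x :+ y) :- y) refl (deviation i inside Ss) (deviation i outside Ss))

        0<L : 0# < L
        0<L = fromℕ-positive (BoundedMarginals.positive bounded)

        1≤Lq : ∀ i s → 1# ≤ L * E D (𝟙 ∘ hasSide i s)
        1≤Lq i s = ≤-respˡ-≈ (x*[y/x]≈y 1# (0<⇒≉0 0<L)) (*-monoʳ-≤ (proj₁ 0<L) (lower s))
          where
          lower : ∀ s → 1# / L ≤ E D (𝟙 ∘ hasSide i s)
          lower inside  = ≤-respʳ-≈ (Pr≈E D (i ∈?_)) (BoundedMarginals.in-lower bounded i)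
          lower outside = ≤-respʳ-≈ (Pr≈E D (λ S → ¬? (i ∈? S))) (BoundedMarginals.out-lower bounded i)

        R≈ : R ≈ fromℕ 4 * (N * N)
        R≈ = trans (fromℕ-* 4 (suc n ℕ.* suc n)) (*-congˡ (fromℕ-* (suc n) (suc n)))

        1≤precision : 1 ℕ.≤ precision n
        1≤precision = ℕ.s≤s ℕ.z≤n

        1≤R : 1# ≤ R
        1≤R = ≤-respˡ-≈ (+-identityʳ 1#) (fromℕ-mono-≤ 1≤precision)

        0<R : 0# < R
        0<R = <-≤-trans 0<1 1≤R

        -- `v̂` is a difference of two averages, each within O / R of its mean.
        θ : Carrier
        θ = (O + O) / R

        0≤θ : 0# ≤ θ
        0≤θ = *-nonneg (+-nonneg (proj₁ 0<O) (proj₁ 0<O)) (⁻¹-nonneg 0<R)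

        Rθ : R * θ ≈ O + O
        Rθ = x*[y/x]≈y (O + O) (0<⇒≉0 0<R)

        -- The 4 in `precision` is spent here: a factor two from `θ` and a factor two from the two
        -- sets compared.
        error≤εO : fromℕ k * θ + fromℕ k * θ ≤ ε n * O
        error≤εO = *-cancelˡ-≤ 0<R (begin
          R * (fromℕ k * θ + fromℕ k * θ)
            ≈⟨ solve 3 (λ R k t → R :* (k :* t :+ k :* t) := (k :+ k) :* (R :* t)) refl R (fromℕ k) θ ⟩
          (fromℕ k + fromℕ k) * (R * θ)
            ≈⟨ *-congˡ Rθ ⟩
          (fromℕ k + fromℕ k) * (O + O)
            ≤⟨ *-monoˡ-≤ (+-nonneg (proj₁ 0<O) (proj₁ 0<O)) (+-mono-≤ k≤N k≤N) ⟩
          (N + N) * (O + O)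
            -- The nested sum is what `fromℕ 4` unfolds to by definition.
            ≈⟨ solve 2 (λ N O → (N :+ N) :* (O :+ O) := (con (+ 1) :+ (con (+ 1) :+ (con (+ 1) :+ (con (+ 1) :+ con (+ 0))))) :* (N :* con (+ 1) :* O)) refl N O ⟩
          fromℕ 4 * (N * 1# * O)
            ≈⟨ *-congˡ (*-congʳ (*-congˡ (ε-inverse n))) ⟨
          fromℕ 4 * (N * (N * ε n) * O)
            ≈⟨ solve 4 (λ q N e O → q :* (N :* (N :* e) :* O) := q :* (N :* N) :* (e :* O)) refl (fromℕ 4) N (ε n) O ⟩
          fromℕ 4 * (N * N) * (ε n * O)
            ≈⟨ *-congʳ R≈ ⟨
          R * (ε n * O) ∎)
          where
          k≤N : fromℕ k ≤ N
          k≤N = fromℕ-mono-≤ (ℕ.≤-trans k≤n (ℕ.n≤1+n n))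

        v : Fin n → Carrier
        v i = c i inside - c i outside

        v≈ : ∀ i → E D (λ S → gain f S i) ≈ v i
        v≈ i = E-- D (λ S → f (S [ i ]≔ inside)) (λ S → f (S [ i ]≔ outside))

        v≤ : ∀ i → v i ≤ f ⁅ i ⁆
        v≤ i = begin
          v i                        ≈⟨ v≈ i ⟨
          E D (λ S → gain f S i)     ≤⟨ D.E-mono (λ S → gain≤ S i) ⟩
          E D (λ _ → f ⁅ i ⁆)        ≈⟨ D.E-const (f ⁅ i ⁆) ⟩
          f ⁅ i ⁆                    ∎

        v≥ : ∀ i → μ * f ⁅ i ⁆ ≤ v i
        v≥ i = begin
          μ * f ⁅ i ⁆                ≈⟨ D.E-const (μ * f ⁅ i ⁆) ⟨
          E D (λ _ → μ * f ⁅ i ⁆)    ≤⟨ D.E-mono (λ S → gain≥ S i) ⟩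
          E D (λ S → gain f S i)     ≈⟨ v≈ i ⟩
          v i                        ∎

        threshold : Carrier
        threshold = O * fromℕ m * (O * fromℕ m)

        module _ (Ss : Vec (Subset n) m) (small : U Ss ≤ threshold) where

          sideAverage : Fin n → Side → Carrier
          sideAverage i s = ∑ (Vec.toList Ss) (λ S → 𝟙 (hasSide i s S) * f S) / ∑ (Vec.toList Ss) (𝟙 ∘ hasSide i s)

          sideAverage-close : ∀ i s → ∣ R * (sideAverage i s - c i s) ∣≤ O
          sideAverage-close i s = Avg.average-close i s Ss 1≤R 0<L 0<O 0<m (1≤Lq i s) (≤-trans (deviation≤U Ss i s) small)

          v̂≈ : ∀ i → v̂ (observe f Ss) i ≈ sideAverage i inside - sideAverage i outside
          v̂≈ i = +-cong (average-filter f (i ∈?_) Ss) (-‿cong (average-filter f (λ S → ¬? (i ∈? S)) Ss))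

          v̂-close : ∀ i → ∣ v̂ (observe f Ss) i - v i ∣≤ θ
          v̂-close i = let loI , hiI = sideAverage-close i inside ; loO , hiO = sideAverage-close i outside in
              *-cancelˡ-≤ 0<R (begin
                R * - θ                      ≈⟨ solve 2 (λ R t → R :* (:- t) := :- (R :* t)) refl R θ ⟩
                - (R * θ)                    ≈⟨ -‿cong Rθ ⟩
                - (O + O)                    ≈⟨ solve 1 (λ O → :- (O :+ O) := (:- O) :- O) refl O ⟩
                - O - O                      ≤⟨ +-mono-≤ loI (neg-mono-≤ hiO) ⟩
                R * (sideAverage i inside - c i inside) - R * (sideAverage i outside - c i outside)
                                             ≈⟨ split i ⟨
                R * (v̂ (observe f Ss) i - v i) ∎)
            , *-cancelˡ-≤ 0<R (begin
                R * (v̂ (observe f Ss) i - v i) ≈⟨ split i ⟩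
                R * (sideAverage i inside - c i inside) - R * (sideAverage i outside - c i outside)
                                             ≤⟨ +-mono-≤ hiI (neg-mono-≤ loO) ⟩
                O - - O                      ≈⟨ solve 1 (λ O → O :- (:- O) := O :+ O) refl O ⟩
                O + O                        ≈⟨ Rθ ⟨
                R * θ                        ∎)
            where
            split : ∀ i → R * (v̂ (observe f Ss) i - v i)
                          ≈ R * (sideAverage i inside - c i inside) - R * (sideAverage i outside - c i outside)
            split i = trans (*-congˡ (+-congʳ (v̂≈ i)))
              (solve 5 (λ R x y u w → R :* ((x :- y) :- (u :- w)) := R :* (x :- u) :- R :* (y :- w)) refl
                R (sideAverage i inside) (sideAverage i outside) (c i inside) (c i outside))

          good : Good Ss
          good = ∣S∣≡k , (begin
            (μ * μ - ε n) * O
              ≈⟨ solve 3 (λ μ² e O → (μ² :- e) :* O := μ² :* O :- e :* O) refl (μ * μ) (ε n) O ⟩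
            μ * μ * O - ε n * O
              ≤⟨ +-mono-≤ (*-monoʳ-≤ (square-nonneg μ) (≤-respˡ-≈ (reflexive (≡.sym O≡fT)) fT≤fT′)) (neg-mono-≤ error≤εO) ⟩
            μ * μ * f T′ - (fromℕ k * θ + fromℕ k * θ)
              ≤⟨ maximiser-approximates {f = f} 0≤μ μ≤1 (nonneg ∅) 0≤θ gain≤ gain≥ v≤ v≥ v̂-close ∣S∣≡k ∣T′∣≡k (maximal T′ ∣T′∣≡k) ⟩
            f (output Ss) ∎)
            where
            ∣S∣≡k = proj₁ (isMax (observe f Ss))
            maximal = proj₂ (isMax (observe f Ss))
            T = proj₁ (optimum-attained f k)
            O≡fT = proj₂ (proj₂ (optimum-attained f k))
            extension = extend-to-size f gain≥0 T (proj₁ (proj₂ (optimum-attained f k))) k≤n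
            T′ = proj₁ extension
            ∣T′∣≡k = proj₁ (proj₂ extension)
            fT≤fT′ = proj₂ (proj₂ extension)

        -- There are 2 n deviations, each bounded with B = N O. The factor O² comes out, and what
        -- remains besides `m` depends only on `n` and `P`, so the sample size can be fixed before
        -- `f` is known.
        E-U : E (iid m D) U ≤ O * O * fromℕ m * fromℕ (variance (eval P n) n)
        E-U = begin
          E (iid m D) U
            ≈⟨ E-∑ (iid m D) (allFin n) (λ i Ss → deviation i inside Ss + deviation i outside Ss) ⟩
          ∑ (allFin n) (λ i → E (iid m D) (λ Ss → deviation i inside Ss + deviation i outside Ss))
            ≈⟨ ∑-cong (allFin n) (λ i → E-+ (iid m D) (deviation i inside) (deviation i outside)) ⟩
          ∑ (allFin n) (λ i → E (iid m D) (deviation i inside) + E (iid m D) (deviation i outside))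
            ≤⟨ ∑-mono (allFin n) (λ i → +-mono-≤ (Avg.E-deviation i inside m w O) (Avg.E-deviation i outside m w O)) ⟩
          ∑ (allFin n) (λ _ → β + β)
            ≈⟨ trans (∑-const (allFin n) (β + β)) (*-congʳ (reflexive (≡.cong fromℕ (List.length-tabulate {n = n} id)))) ⟩
          fromℕ n * (β + β)
            ≈⟨ solve 5 (λ n m w N O →
                 let β = m :* (w :* w :* (N :* O :* (N :* O) :+ O :* O)) in
                 n :* (β :+ β) := O :* O :* m :* ((con (+ 1) :+ (con (+ 1) :+ con (+ 0))) :* n :* (w :* w :* (N :* N :+ (con (+ 1) :+ con (+ 0))))))
               refl (fromℕ n) (fromℕ m) w N O ⟩
          O * O * fromℕ m * (fromℕ 2 * fromℕ n * (w * w * (N * N + fromℕ 1)))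
            ≈⟨ *-congˡ variance≈ ⟨
          O * O * fromℕ m * fromℕ (variance (eval P n) n) ∎
          where
          β : Carrier
          β = fromℕ m * (w * w * (N * O * (N * O) + O * O))
          w′ : ℕ
          w′ = 2 ℕ.* (precision n ℕ.* eval P n)
          w≈ : fromℕ w′ ≈ w
          w≈ = trans (fromℕ-* 2 (precision n ℕ.* eval P n))
            (*-cong (+-congˡ (+-identityʳ 1#)) (fromℕ-* (precision n) (eval P n)))
          variance≈ : fromℕ (variance (eval P n) n) ≈ fromℕ 2 * fromℕ n * (w * w * (N * N + fromℕ 1))
          variance≈ = trans (fromℕ-* (2 ℕ.* n) (w′ ℕ.* w′ ℕ.* (suc n ℕ.* suc n ℕ.+ 1)))
            (*-cong (fromℕ-* 2 n) (trans (fromℕ-* (w′ ℕ.* w′) (suc n ℕ.* suc n ℕ.+ 1))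
              (*-cong (trans (fromℕ-* w′ w′) (*-cong w≈ w≈))
                      (trans (fromℕ-+ (suc n ℕ.* suc n) 1) (+-congʳ (fromℕ-* (suc n) (suc n)))))))

      -- Markov's inequality at the threshold (O m)²: the mean of `U` is at most O² m times the
      -- variance bound, hence at most δ times the threshold.
      Pr-good : ∀ {δ} → fromℕ (variance (eval P n) n) ≤ fromℕ m * δ →
        1# - δ ≤ Pr (iid m D) (λ Ss → approximates? f k (μ * μ - ε n) (output Ss))
      Pr-good {δ} variance≤ = 1-δ≤ 0<O²m² (begin
        threshold * (1# - Pr (iid m D) good?)
          ≤⟨ Dᵐ.markov good? U threshold (λ Ss → ∑-nonneg (allFin n) (deviations-nonneg Ss)) bad⇒large ⟩
        E (iid m D) U
          ≤⟨ E-U ⟩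
        O * O * fromℕ m * fromℕ (variance (eval P n) n)
          ≤⟨ *-monoʳ-≤ (*-nonneg (square-nonneg O) (fromℕ-nonneg m)) variance≤ ⟩
        O * O * fromℕ m * (fromℕ m * δ)
          ≈⟨ solve 3 (λ O m d → O :* O :* m :* (m :* d) := O :* m :* (O :* m) :* d) refl O (fromℕ m) δ ⟩
        threshold * δ ∎)
        where
        good? : ∀ Ss → Dec (Good Ss)
        good? Ss = approximates? f k (μ * μ - ε n) (output Ss)
        0<Om : 0# < O * fromℕ m
        0<Om = *-positive 0<O (fromℕ-positive 0<m)
        0<O²m² : 0# < threshold
        0<O²m² = *-positive 0<Om 0<Om
        bad⇒large : ∀ Ss → ¬ Good Ss → threshold ≤ U Ss
        bad⇒large Ss bad with ≤-total (U Ss) threshold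
        ... | inj₁ small = contradiction (good Ss small) bad
        ... | inj₂ large = large

    -- No outcome is bad, so Markov's inequality applies to the zero function with threshold 1.
    Pr-good-if-k≡0 : ∀ {δ} → 0# ≤ δ → k ≡ 0 →
      1# - δ ≤ Pr (iid m D) (λ Ss → approximates? f k (μ * μ - ε n) (output Ss))
    Pr-good-if-k≡0 {δ} 0≤δ k≡0 = 1-δ≤ 0<1 (begin
      1# * (1# - Pr (iid m D) good?)
        ≤⟨ Dᵐ.markov good? (λ _ → 0#) 1# (λ _ → ≤-refl) (λ Ss bad → contradiction (always-good-if-k≡0 k≡0 Ss) bad) ⟩
      E (iid m D) (λ _ → 0#)
        ≈⟨ Dᵐ.E-const 0# ⟩
      0#
        ≤⟨ 0≤δ ⟩
      δ
        ≈⟨ *-identityˡ δ ⟨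
      1# * δ ∎)
      where
      good? : ∀ Ss → Dec (Good Ss)
      good? Ss = approximates? f k (μ * μ - ε n) (output Ss)

-- Choice of the sample size

theorem4 : ∀ {a ℓ₁ ℓ₂} (K : ArchimedeanOrderedField a ℓ₁ ℓ₂) →
    let open ArchimedeanOrderedField K
        open Optimization K
        open ProductDistribution
    in
    (P : Polynomial) (δ : Carrier) → 0# < δ → δ < 1# →
    ∃₂ λ (Q : Polynomial) (ε : ℕ → Carrier) → Vanishing ε ×
      (∀ (n k m : ℕ) (f : SetFunction n) (c : Carrier)
         (𝒟 : ProductDistribution n) (maxMargCont : Algorithm n) →
         k ℕ.≤ n →
         eval Q n ℕ.≤ m →
         Nonnegative f → Monotone f → Submodular f → HasCurvature f c →
         BoundedMarginals P 𝒟 →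
         IsMaxMargCont k maxMargCont →
         1# - δ ≤ Pr (iid m (distribution 𝒟))
                     (λ Ss → approximates? f k ((1# - c) * (1# - c) - ε n)
                               (maxMargCont (observe f Ss))))
-- `P` and `δ` enter only the sample-size polynomial; `ε` is the same for all of them.
theorem4 K P δ 0<δ _ = proj₁ Q , ε , ε-vanishing , bound
  where
  open ArchimedeanOrderedField K hiding (zero)
  open Optimization K
  open IntegerSolver K
  open OrderedFieldProperties K
  open Approximation K
  open ProductDistribution
  open import Relation.Binary.Reasoning.PartialOrder ≤-poset

  d : ℕ
  d = proj₁ (archimedean-inverse 0<δ)

  Q : IsPolynomial (λ n → 1 ℕ.+ d ℕ.* variance (eval P n) n)
  Q = isPolynomial-sampleSize d P

  bound : ∀ (n k m : ℕ) (f : SetFunction n) (c : Carrier)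
    (𝒟 : ProductDistribution n) (maxMargCont : Algorithm n) →
    k ℕ.≤ n → eval (proj₁ Q) n ℕ.≤ m →
    Nonnegative f → Monotone f → Submodular f → HasCurvature f c →
    BoundedMarginals P 𝒟 → IsMaxMargCont k maxMargCont →
    1# - δ ≤ Pr (iid m (distribution 𝒟))
                (λ Ss → approximates? f k ((1# - c) * (1# - c) - ε n) (maxMargCont (observe f Ss)))
  bound n k m f c 𝒟 alg k≤n Q≤m nonneg mono sub (μ , (μ-least , e , S , f≉0 , μ-attained) , c≈1-μ) bounded isMax
    = cases (k ℕ.≟ 0)
    where
    μ≈1-c : μ ≈ 1# - c
    μ≈1-c = trans (solve 1 (λ μ → μ := con (+ 1) :- (con (+ 1) :- μ)) refl μ) (+-congˡ (-‿cong (sym c≈1-μ)))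

    -- The minimal ratio is restated at `1# - c`, so that `μ` in the earlier bounds becomes
    -- literally the expression in the goal.
    min : IsMinimalRatio f (1# - c)
    min = (λ e S f≉0 → ≤-respˡ-≈ μ≈1-c (μ-least e S f≉0)) , e , S , f≉0 , trans (sym μ≈1-c) μ-attained

    κ : ℕ
    κ = variance (eval P n) n

    dκ<m : d ℕ.* κ ℕ.< m
    dκ<m = ≡.subst (ℕ._≤ m) (proj₂ Q n) Q≤m

    -- Since d δ ≥ 1, taking at least d κ samples brings κ / m down to δ.
    κ≤mδ : fromℕ κ ≤ fromℕ m * δ
    κ≤mδ = begin
      fromℕ κ                    ≈⟨ *-identityʳ _ ⟨
      fromℕ κ * 1#               ≤⟨ *-monoʳ-≤ (fromℕ-nonneg κ) (proj₂ (archimedean-inverse 0<δ)) ⟩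
      fromℕ κ * (fromℕ d * δ)    ≈⟨ solve 3 (λ k d x → k :* (d :* x) := d :* k :* x) refl (fromℕ κ) (fromℕ d) δ ⟩
      fromℕ d * fromℕ κ * δ      ≈⟨ *-congʳ (fromℕ-* d κ) ⟨
      fromℕ (d ℕ.* κ) * δ        ≤⟨ *-monoˡ-≤ (proj₁ 0<δ) (fromℕ-mono-≤ (ℕ.<⇒≤ dκ<m)) ⟩
      fromℕ m * δ                ∎

    cases : Dec (k ≡ 0) → 1# - δ ≤ Pr (iid m (distribution 𝒟))
      (λ Ss → approximates? f k ((1# - c) * (1# - c) - ε n) (alg (observe f Ss)))
    cases (yes k≡0) = Pr-good-if-k≡0 {m = m} k≤n nonneg mono sub min bounded isMax (proj₁ 0<δ) k≡0
    cases (no  k≢0) = Pr-good k≤n nonneg mono sub min bounded isMax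
      (ℕ.n≢0⇒n>0 k≢0) (ℕ.≤-<-trans ℕ.z≤n dκ<m) κ≤mδ
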